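{- Let $\mathbf a=(a_1,\dots,a_k)$ be a sequence of nonnegative integers with $\sum_i a_i=n$, and let $0\le j\le k$. Then $|D_j(\mathbf a)|$ is the coefficient of $x_1^{a_1}\cdots x_k^{a_k}$ in the power series expansion of \[ \frac{1}{(1+x_1)\cdots(1+x_j)(1-x_1-\dots-x_k)}. \]
   Context: For a sequence $\mathbf a=(a_1,\dots,a_k)$ of nonnegative integers with sum $n$, put $c_j=a_1+\dots+a_j$ ($c_0=0$) and call $A_j=\{c_{j-1}+1,\dots,c_j\}\subseteq[n]$ the $j$-th block. Let $S_{\mathbf a}$ be the set of permutations $\pi=\pi_1\cdots\pi_n$ of $[n]$ such that $\pi_i>\pi_{i+1}$ whenever $i$ and $i+1$ lie in the same block (no condition between blocks). A fixed point of $\pi$ is an $i$ with $\pi_i=i$; it lies in block $A_j$ if $i\in A_j$. $D_j(\mathbf a)$ denotes the set of permutations in $S_{\mathbf a}$ having no fixed points in the blocks $A_1,\dots,A_j$. -}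

module Defs where

open import Data.Nat as ℕ using (ℕ; zero; suc; _≤_; _<_; _≤?_; _<?_)
import Data.Nat.Properties as ℕP
import Data.Nat.ListAction as LA
open import Data.Fin as Fin using (Fin; toℕ)
import Data.Fin.Properties as FinP
open import Data.Vec as Vec using (Vec; []; _∷_; lookup; toList; zipWith)
import Data.Vec.Properties as VecP
open import Data.List as List using (List; length; filter; allFin; concatMap; upTo)
open import Data.Integer as ℤ using (ℤ; +_; -_)
open import Data.Product using (Σ; ∃; _×_; _,_)
open import Data.Bool using (if_then_else_)
open import Relation.Binary.PropositionalEquality using (_≡_; _≢_)
open import Relation.Nullary using (Dec; yes; no; ¬_; does)
open import Relation.Nullary.Decidable using (_×-dec_; _→-dec_; ¬?)

-- Blocks.  Conventions: positions and values are 0-based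
-- (position p ∈ {0..n-1} stands for i = p+1 of the paper, value v for v+1),
-- blocks are indexed by t : Fin k (t stands for block A_{t+1}).

c : ∀ {k} → Vec ℕ k → ℕ → ℕ
c a m = LA.sum (List.take m (toList a))

-- position p lies in block A_{t+1} = {c_t + 1, ..., c_{t+1}} (shifted to 0-based)
InBlock : ∀ {k} → Vec ℕ k → Fin k → ℕ → Set
InBlock a t p = (c a (toℕ t) ≤ p) × (p < c a (suc (toℕ t)))

inBlock? : ∀ {k} (a : Vec ℕ k) (t : Fin k) (p : ℕ) → Dec (InBlock a t p)
inBlock? a t p = (c a (toℕ t) ≤? p) ×-dec (p <? c a (suc (toℕ t)))

SameBlock : ∀ {k} → Vec ℕ k → ℕ → ℕ → Set
SameBlock a p q = ∃ λ t → InBlock a t p × InBlock a t q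

sameBlock? : ∀ {k} (a : Vec ℕ k) (p q : ℕ) → Dec (SameBlock a p q)
sameBlock? a p q = FinP.any? (λ t → inBlock? a t p ×-dec inBlock? a t q)

InFirstBlocks : ∀ {k} → Vec ℕ k → ℕ → ℕ → Set
InFirstBlocks a j p = ∃ λ t → (toℕ t < j) × InBlock a t p

inFirstBlocks? : ∀ {k} (a : Vec ℕ k) (j p : ℕ) → Dec (InFirstBlocks a j p)
inFirstBlocks? a j p = FinP.any? (λ t → (toℕ t <? j) ×-dec inBlock? a t p)

IsPerm : ∀ {n} → Vec (Fin n) n → Set
IsPerm {n} π = (∀ (i j : Fin n) → lookup π i ≡ lookup π j → i ≡ j)
             × (∀ (y : Fin n) → ∃ λ i → lookup π i ≡ y)

isPerm? : ∀ {n} (π : Vec (Fin n) n) → Dec (IsPerm π)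
isPerm? π = FinP.all? (λ i → FinP.all? (λ j → (lookup π i FinP.≟ lookup π j) →-dec (i FinP.≟ j)))
       ×-dec FinP.all? (λ y → FinP.any? (λ i → lookup π i FinP.≟ y))

Descents : ∀ {k n} → Vec ℕ k → Vec (Fin n) n → Set
Descents {n = n} a π = ∀ (i i' : Fin n) → toℕ i' ≡ suc (toℕ i) →
  SameBlock a (toℕ i) (toℕ i') → lookup π i' Fin.< lookup π i

descents? : ∀ {k n} (a : Vec ℕ k) (π : Vec (Fin n) n) → Dec (Descents a π)
descents? a π = FinP.all? (λ i → FinP.all? (λ i' →
  (toℕ i' ℕP.≟ suc (toℕ i)) →-dec (sameBlock? a (toℕ i) (toℕ i') →-dec (lookup π i' FinP.<? lookup π i))))

NoFixedIn : ∀ {k n} → Vec ℕ k → ℕ → Vec (Fin n) n → Set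
NoFixedIn {n = n} a j π = ∀ (p : Fin n) → InFirstBlocks a j (toℕ p) → lookup π p ≢ p

noFixedIn? : ∀ {k n} (a : Vec ℕ k) (j : ℕ) (π : Vec (Fin n) n) → Dec (NoFixedIn a j π)
noFixedIn? a j π = FinP.all? (λ p → inFirstBlocks? a j (toℕ p) →-dec ¬? (lookup π p FinP.≟ p))

InD : ∀ {k} (a : Vec ℕ k) (j : ℕ) → Vec (Fin (Vec.sum a)) (Vec.sum a) → Set
InD a j π = IsPerm π × Descents a π × NoFixedIn a j π

inD? : ∀ {k} (a : Vec ℕ k) (j : ℕ) (π : Vec (Fin (Vec.sum a)) (Vec.sum a)) → Dec (InD a j π)
inD? a j π = isPerm? π ×-dec descents? a π ×-dec noFixedIn? a j π

allVecs : (m n : ℕ) → List (Vec (Fin n) m)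
allVecs zero    n = [] List.∷ List.[]
allVecs (suc m) n = concatMap (λ v → List.map (Vec._∷ v) (allFin n)) (allVecs m n)

cardD : ∀ {k} (a : Vec ℕ k) (j : ℕ) → ℕ
cardD a j = length (filter (inD? a j) (allVecs (Vec.sum a) (Vec.sum a)))

-- Formal power series in k variables x_1..x_k over ℤ:
-- a series is its coefficient function, exponent vector ↦ coefficient.

Series : ℕ → Set
Series k = Vec ℕ k → ℤ

below : ∀ {k} → Vec ℕ k → List (Vec ℕ k)
below []      = [] List.∷ List.[]
below (x ∷ a) = concatMap (λ i → List.map (i ∷_) (below a)) (upTo (suc x))

sumℤ : List ℤ → ℤ
sumℤ = List.foldr ℤ._+_ (+ 0)

_≟v_ : ∀ {k} (a b : Vec ℕ k) → Dec (a ≡ b)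
_≟v_ = VecP.≡-dec ℕP._≟_

zeroVec : ∀ {k} → Vec ℕ k
zeroVec = Vec.replicate _ 0

unitVec : ∀ {k} → Fin k → Vec ℕ k
unitVec t = Vec.updateAt (Vec.replicate _ 0) t (λ _ → 1)

oneS : ∀ {k} → Series k
oneS a = if does (a ≟v zeroVec) then + 1 else + 0

varS : ∀ {k} → Fin k → Series k
varS t a = if does (a ≟v unitVec t) then + 1 else + 0

_+S_ : ∀ {k} → Series k → Series k → Series k
(f +S g) a = f a ℤ.+ g a

-S_ : ∀ {k} → Series k → Series k
(-S f) a = - f a

_*S_ : ∀ {k} → Series k → Series k → Series k
(f *S g) a = sumℤ (List.map (λ b → f b ℤ.* g (zipWith ℕ._∸_ a b)) (below a))

-- multiplicative inverse of a series Q with constant term 1: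
-- the unique g with g * Q = 1, computed degree by degree:
-- g(0) = 1,  g(a) = - Σ_{b ≤ a, b ≠ a} g(b) Q(a - b).
-- (fuel = total degree + 1 suffices, since b < a has smaller total degree)
invFuel : ∀ {k} → ℕ → Series k → Series k
invFuel zero     Q a = + 0
invFuel (suc f) Q a with a ≟v zeroVec
... | yes _ = + 1
... | no  _ = - sumℤ (List.map (λ b → invFuel f Q b ℤ.* Q (zipWith ℕ._∸_ a b))
                                (filter (λ b → ¬? (b ≟v a)) (below a)))

inverseS : ∀ {k} → Series k → Series k
inverseS Q a = invFuel (suc (Vec.sum a)) Q a

coeff : ∀ {k} → Series k → Vec ℕ k → ℤ
coeff f a = f a

denom : (k j : ℕ) → Series k
denom k j = List.foldr _*S_
  (oneS +S (-S List.foldr _+S_ (λ _ → + 0) (List.map varS (allFin k))))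
  (List.map (λ t → oneS +S varS t) (filter (λ t → toℕ t <? j) (allFin k)))

{-# OPTIONS --safe #-}
-- Write F_j for the generating function of |D_j(a)|.  A decreasing block contains at most one fixed point.
-- Deleting a fixed point from block t = j + 1 leaves a permutation without fixed points in that block, and a
-- fixed point can be inserted back into such a block at exactly one place; hence (1 + x_t) F_t = F_j.
-- The largest value of a permutation in S_a sits at the beginning of a nonempty block; deleting it gives
-- |S_a| = Σ_t |S_{a - e_t}| for a ≠ 0, that is (1 - x_1 - ... - x_k) F_0 = 1.
module Submission where

open import Defs
open import Algebra.Properties.CommutativeSemigroup using (interchange)
open import Data.Empty using (⊥-elim)
open import Data.Fin as Fin using (Fin; zero; suc; toℕ; fromℕ; fromℕ<; punchIn; punchOut)
import Data.Fin.Properties as FinP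
open import Data.Integer as ℤ using (ℤ; +_; -_)
import Data.Integer.Properties as ℤP
open import Data.List as List using (List; []; _∷_; _++_; concatMap; upTo; allFin; filter; length)
open import Data.List.Membership.Propositional using (_∈_; find; lose)
import Data.List.Membership.Propositional.Properties as ∈P
import Data.List.Properties as ListP
open import Data.List.Relation.Unary.All as All using (All; []; _∷_)
import Data.List.Relation.Unary.All.Properties as AllP
open import Data.List.Relation.Unary.AllPairs as AllPairs using ([]; _∷_)
import Data.List.Relation.Unary.AllPairs.Properties as AllPairsP
open import Data.List.Relation.Unary.Any as Any using (here)
import Data.List.Relation.Unary.Any.Properties as AnyP
open import Data.List.Relation.Unary.Unique.Propositional using (Unique)
import Data.List.Relation.Unary.Unique.Propositional.Properties as UniqueP
open import Data.Maybe as Maybe using (Maybe; just; nothing; maybe)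
open import Data.Nat as ℕ using (ℕ; zero; suc; _≤_; _<_; z≤n; s≤s; _+_)
import Data.Nat.Properties as ℕP
open import Data.Product using (∃; _×_; _,_; proj₁; proj₂)
open import Data.Sum using (_⊎_; inj₁; inj₂)
open import Data.Vec as Vec using (Vec; []; _∷_; zipWith; updateAt; lookup; insertAt; tabulate)
import Data.Vec.Properties as VecP
open import Data.Vec.Relation.Binary.Pointwise.Extensional using (ext; Pointwise-≡⇒≡)
open import Function using (_∘_)
open import Relation.Binary.Definitions using (tri<; tri≈; tri>)
open import Relation.Binary.PropositionalEquality
open import Relation.Nullary using (yes; no; ¬_; Dec)
open import Relation.Nullary.Decidable using (_×-dec_; ¬?; dec-false; dec-true)
open ≡-Reasoning

-- Formal power series

-- As `inverseS` is computed by recursion on the total degree, the claim reduces to two facts: the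
-- denominator has constant term 1, and the series of the counts times the denominator is 1. The
-- factors 1 + x_t act as operators that can be pulled out of a product on either side, so the
-- counts absorb them one at a time. Two reasons stand behind the combinatorial steps. In a
-- decreasing block, value minus position strictly decreases, so it changes sign at most once: this
-- gives at most one fixed point, and if there is none, exactly one gap that accepts one. Inserting
-- the value p at position p renumbers positions and values by the same rule, so an old entry is
-- fixed afterwards exactly when it was fixed before. Hence the conditions on the other blocks
-- survive in both directions.

∑ : ∀ {A : Set} → (A → ℤ) → List A → ℤ
∑ h xs = sumℤ (List.map h xs)

∑-cong : ∀ {A : Set} {h h' : A → ℤ} → (∀ x → h x ≡ h' x) → ∀ xs → ∑ h xs ≡ ∑ h' xs
∑-cong e xs = cong sumℤ (ListP.map-cong e xs)

∑-++ : ∀ {A : Set} (h : A → ℤ) xs ys → ∑ h (xs ++ ys) ≡ ∑ h xs ℤ.+ ∑ h ys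
∑-++ h []       ys = sym (ℤP.+-identityˡ _)
∑-++ h (x ∷ xs) ys = trans (cong (ℤ._+_ (h x)) (∑-++ h xs ys)) (sym (ℤP.+-assoc (h x) _ _))

∑-map : ∀ {A B : Set} (h : B → ℤ) (f : A → B) xs → ∑ h (List.map f xs) ≡ ∑ (h ∘ f) xs
∑-map h f xs = cong sumℤ (sym (ListP.map-∘ xs))

∑-concatMap : ∀ {A B : Set} (h : B → ℤ) (f : A → List B) xs →
              ∑ h (concatMap f xs) ≡ ∑ (λ x → ∑ h (f x)) xs
∑-concatMap h f []       = refl
∑-concatMap h f (x ∷ xs) =
  trans (∑-++ h (f x) (concatMap f xs)) (cong (ℤ._+_ (∑ h (f x))) (∑-concatMap h f xs))

∑-zero : ∀ {A : Set} {h : A → ℤ} → (∀ x → h x ≡ + 0) → ∀ xs → ∑ h xs ≡ + 0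
∑-zero e []       = refl
∑-zero e (x ∷ xs) = cong₂ ℤ._+_ (e x) (∑-zero e xs)

∑-+ : ∀ {A : Set} (h h' : A → ℤ) xs → ∑ (λ x → h x ℤ.+ h' x) xs ≡ ∑ h xs ℤ.+ ∑ h' xs
∑-+ h h' []       = refl
∑-+ h h' (x ∷ xs) =
  trans (cong (ℤ._+_ (h x ℤ.+ h' x)) (∑-+ h h' xs))
        (interchange ℤP.+-commutativeSemigroup (h x) (h' x) (∑ h xs) (∑ h' xs))

∑-neg : ∀ {A : Set} (h : A → ℤ) xs → ∑ (λ x → - h x) xs ≡ - ∑ h xs
∑-neg h []       = refl
∑-neg h (x ∷ xs) =
  trans (cong (ℤ._+_ (- h x)) (∑-neg h xs)) (sym (ℤP.neg-distrib-+ (h x) (∑ h xs)))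

∑-upTo-last : ∀ (h : ℕ → ℤ) n → ∑ h (upTo (suc n)) ≡ ∑ h (upTo n) ℤ.+ h n
∑-upTo-last h n = begin
  ∑ h (upTo (suc n))             ≡⟨ cong (∑ h) (ListP.upTo-∷ʳ n) ⟨
  ∑ h (upTo n ++ n ∷ [])         ≡⟨ ∑-++ h (upTo n) (n ∷ []) ⟩
  ∑ h (upTo n) ℤ.+ (h n ℤ.+ + 0) ≡⟨ cong (ℤ._+_ (∑ h (upTo n))) (ℤP.+-identityʳ (h n)) ⟩
  ∑ h (upTo n) ℤ.+ h n           ∎

∑-upTo-first : ∀ (h : ℕ → ℤ) n → ∑ h (upTo (suc n)) ≡ h 0 ℤ.+ ∑ (h ∘ suc) (upTo n)
∑-upTo-first h n = cong (ℤ._+_ (h 0)) (trans (cong (∑ h) (sym (ListP.map-upTo suc n))) (∑-map h suc (upTo n)))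

∑-upTo-cong : ∀ {h h' : ℕ → ℤ} n → (∀ i → i < n → h i ≡ h' i) → ∑ h (upTo n) ≡ ∑ h' (upTo n)
∑-upTo-cong {h} {h'} zero    e = refl
∑-upTo-cong {h} {h'} (suc n) e = begin
  ∑ h (upTo (suc n))                ≡⟨ ∑-upTo-first h n ⟩
  h 0 ℤ.+ ∑ (h ∘ suc) (upTo n)      ≡⟨ cong₂ ℤ._+_ (e 0 (s≤s z≤n))
                                         (∑-upTo-cong n (λ i i<n → e (suc i) (s≤s i<n))) ⟩
  h' 0 ℤ.+ ∑ (h' ∘ suc) (upTo n)    ≡⟨ ∑-upTo-first h' n ⟨
  ∑ h' (upTo (suc n))               ∎

dec : ∀ {k} → Fin k → Vec ℕ k → Maybe (Vec ℕ k)
dec zero    (zero  ∷ a) = nothing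
dec zero    (suc x ∷ a) = just (x ∷ a)
dec (suc t) (x     ∷ a) = Maybe.map (x ∷_) (dec t a)

inc : ∀ {k} → Fin k → Vec ℕ k → Vec ℕ k
inc t b = updateAt b t suc

dec-just : ∀ {k} (t : Fin k) a {b} → dec t a ≡ just b → a ≡ inc t b
dec-just zero    (suc x ∷ a) refl = refl
dec-just (suc t) (x     ∷ a) e with dec t a in e'
dec-just (suc t) (x     ∷ a) refl | just b = cong (x ∷_) (dec-just t a e')

-- The coefficient of the i-th power of the first variable, as a series in the remaining ones. The
-- facts about products go by induction on the number of variables through these slices.
_↓_ : ∀ {k} → Series (suc k) → ℕ → Series k
(f ↓ i) b = f (i ∷ b)

infix 4 _≈_
_≈_ : ∀ {k} → Series k → Series k → Set
f ≈ g = ∀ a → f a ≡ g a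

*S-cong : ∀ {k} {f f' g g' : Series k} → f ≈ f' → g ≈ g' → f *S g ≈ f' *S g'
*S-cong e e' a = ∑-cong (λ b → cong₂ ℤ._*_ (e b) (e' _)) (below a)

-- `below` groups the exponents by their first entry, so the product is a one-variable convolution
-- whose coefficients are the slices.
*S-cons : ∀ {k} (f g : Series (suc k)) x a →
          (f *S g) (x ∷ a) ≡ ∑ (λ i → ((f ↓ i) *S (g ↓ (x ℕ.∸ i))) a) (upTo (suc x))
*S-cons f g x a =
  trans (∑-concatMap _ (λ i → List.map (i ∷_) (below a)) (upTo (suc x)))
        (∑-cong (λ i → ∑-map _ (i ∷_) (below a)) (upTo (suc x)))

*S-zeroʳ : ∀ {k} (f : Series k) {g} → (∀ b → g b ≡ + 0) → ∀ a → (f *S g) a ≡ + 0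
*S-zeroʳ f e a = ∑-zero (λ b → trans (cong (f b ℤ.*_) (e _)) (ℤP.*-zeroʳ (f b))) (below a)

*S-zeroˡ : ∀ {k} {f : Series k} g → (∀ b → f b ≡ + 0) → ∀ a → (f *S g) a ≡ + 0
*S-zeroˡ g e a = ∑-zero (λ b → cong (ℤ._* g _) (e b)) (below a)

*S-distribˡ : ∀ {k} (f g h : Series k) → f *S (g +S h) ≈ (f *S g) +S (f *S h)
*S-distribˡ f g h a =
  trans (∑-cong (λ b → ℤP.*-distribˡ-+ (f b) _ _) (below a)) (∑-+ _ _ (below a))

*S-distribʳ : ∀ {k} (f g h : Series k) → (g +S h) *S f ≈ (g *S f) +S (h *S f)
*S-distribʳ f g h a =
  trans (∑-cong (λ b → ℤP.*-distribʳ-+ (f _) (g b) (h b)) (below a)) (∑-+ _ _ (below a))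

*S-neg : ∀ {k} (f g : Series k) → f *S (-S g) ≈ -S (f *S g)
*S-neg f g a = trans (∑-cong (λ b → sym (ℤP.neg-distribʳ-* (f b) _)) (below a)) (∑-neg _ (below a))

*S-oneʳ : ∀ {k} (f : Series k) → f *S oneS ≈ f
*S-oneʳ f []      = trans (ℤP.+-identityʳ _) (ℤP.*-identityʳ (f []))
*S-oneʳ f (x ∷ a) = begin
  (f *S oneS) (x ∷ a)
    ≡⟨ *S-cons f oneS x a ⟩
  ∑ term (upTo (suc x))
    ≡⟨ ∑-upTo-last term x ⟩
  ∑ term (upTo x) ℤ.+ term x
    ≡⟨ cong₂ ℤ._+_ (trans (∑-upTo-cong x vanish) (∑-zero (λ _ → refl) (upTo x))) last ⟩
  + 0 ℤ.+ f (x ∷ a)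
    ≡⟨ ℤP.+-identityˡ _ ⟩
  f (x ∷ a) ∎
  where
  term : ℕ → ℤ
  term i = ((f ↓ i) *S (oneS ↓ (x ℕ.∸ i))) a
  vanish : ∀ i → i < x → term i ≡ + 0
  -- For `i < x` the first exponent left to `oneS` is a successor, where `oneS` evaluates to 0; only
  -- the term `i = x` survives.
  vanish i i<x with x ℕ.∸ i | ℕP.m<n⇒0<n∸m i<x
  ... | suc d | _ = *S-zeroʳ (f ↓ i) (λ _ → refl) a
  last : term x ≡ f (x ∷ a)
  last rewrite ℕP.n∸n≡0 x = *S-oneʳ (f ↓ x) a

*S-oneˡ : ∀ {k} (f : Series k) → oneS *S f ≈ f
*S-oneˡ f []      = trans (ℤP.+-identityʳ _) (ℤP.*-identityˡ (f []))
*S-oneˡ f (x ∷ a) = begin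
  (oneS *S f) (x ∷ a)
    ≡⟨ *S-cons oneS f x a ⟩
  ∑ term (upTo (suc x))
    ≡⟨ ∑-upTo-first term x ⟩
  term 0 ℤ.+ ∑ (term ∘ suc) (upTo x)
    ≡⟨ cong₂ ℤ._+_ (*S-oneˡ (f ↓ x) a)
         (∑-zero (λ i → *S-zeroˡ (f ↓ (x ℕ.∸ suc i)) (λ _ → refl) a) (upTo x)) ⟩
  f (x ∷ a) ℤ.+ + 0
    ≡⟨ ℤP.+-identityʳ _ ⟩
  f (x ∷ a) ∎
  where
  term : ℕ → ℤ
  term i = ((oneS ↓ i) *S (f ↓ (x ℕ.∸ i))) a

-- Multiplication by the variable x_t.
shift : ∀ {k} → Fin k → Series k → Series k
shift t f a = maybe f (+ 0) (dec t a)

shift-cong : ∀ {k} (t : Fin k) {f g : Series k} → f ≈ g → shift t f ≈ shift t g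
shift-cong t e a with dec t a
... | just b  = e b
... | nothing = refl

shift-suc : ∀ {k} (t : Fin k) (f : Series (suc k)) x a → shift (suc t) f (x ∷ a) ≡ shift t (f ↓ x) a
shift-suc t f x a with dec t a
... | just b  = refl
... | nothing = refl

shift-∑ : ∀ {k} {A : Set} (t : Fin k) (h : A → Series k) xs a →
       ∑ (λ x → shift t (h x) a) xs ≡ shift t (λ b → ∑ (λ x → h x b) xs) a
shift-∑ t h xs a with dec t a
... | just b  = refl
... | nothing = ∑-zero (λ _ → refl) xs

shift-suc-*S : ∀ {k} (t : Fin k) (f g : Series (suc k)) x a →
            ∑ (λ i → shift t ((f ↓ i) *S (g ↓ (x ℕ.∸ i))) a) (upTo (suc x)) ≡ shift (suc t) (f *S g) (x ∷ a)
shift-suc-*S t f g x a = begin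
  ∑ (λ i → shift t (prod i) a) (upTo (suc x))     ≡⟨ shift-∑ t prod (upTo (suc x)) a ⟩
  shift t (λ b → ∑ (λ i → prod i b) (upTo (suc x))) a ≡⟨ shift-cong t (λ b → *S-cons f g x b) a ⟨
  shift t ((f *S g) ↓ x) a                        ≡⟨ shift-suc t (f *S g) x a ⟨
  shift (suc t) (f *S g) (x ∷ a)                  ∎
  where
  prod : ℕ → Series _
  prod i = (f ↓ i) *S (g ↓ (x ℕ.∸ i))

-- For the first variable, the term that leaves exponent 0 to the right factor vanishes, and in
-- every other term that exponent drops by one. For later variables the slices are handled by
-- induction.
*S-shiftʳ : ∀ {k} (t : Fin k) (f g : Series k) → f *S shift t g ≈ shift t (f *S g)
*S-shiftʳ zero f g (zero ∷ a) =
  trans (*S-cons f (shift zero g) 0 a) (cong (ℤ._+ + 0) (*S-zeroʳ (f ↓ 0) (λ _ → refl) a))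
*S-shiftʳ zero f g (suc x ∷ a) = begin
  (f *S shift zero g) (suc x ∷ a)         ≡⟨ *S-cons f (shift zero g) (suc x) a ⟩
  ∑ term (upTo (suc (suc x)))          ≡⟨ ∑-upTo-last term (suc x) ⟩
  ∑ term (upTo (suc x)) ℤ.+ term (suc x) ≡⟨ cong₂ ℤ._+_ (∑-upTo-cong (suc x) shifted) last ⟩
  ∑ (λ i → ((f ↓ i) *S (g ↓ (x ℕ.∸ i))) a) (upTo (suc x)) ℤ.+ + 0 ≡⟨ ℤP.+-identityʳ _ ⟩
  ∑ (λ i → ((f ↓ i) *S (g ↓ (x ℕ.∸ i))) a) (upTo (suc x)) ≡⟨ *S-cons f g x a ⟨
  (f *S g) (x ∷ a)                     ∎
  where
  term : ℕ → ℤ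
  term i = ((f ↓ i) *S (shift zero g ↓ (suc x ℕ.∸ i))) a
  shifted : ∀ i → i < suc x → term i ≡ ((f ↓ i) *S (g ↓ (x ℕ.∸ i))) a
  shifted i (s≤s i≤x) rewrite ℕP.+-∸-assoc 1 i≤x = refl
  last : term (suc x) ≡ + 0
  last rewrite ℕP.n∸n≡0 x = *S-zeroʳ (f ↓ suc x) (λ _ → refl) a
*S-shiftʳ (suc t) f g (x ∷ a) = begin
  (f *S shift (suc t) g) (x ∷ a)
    ≡⟨ *S-cons f (shift (suc t) g) x a ⟩
  ∑ (λ i → ((f ↓ i) *S (shift (suc t) g ↓ (x ℕ.∸ i))) a) (upTo (suc x))
    ≡⟨ ∑-cong (λ i → trans (*S-cong {f = f ↓ i} (λ _ → refl) (shift-suc t g (x ℕ.∸ i)) a)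
                           (*S-shiftʳ t (f ↓ i) (g ↓ (x ℕ.∸ i)) a)) (upTo (suc x)) ⟩
  ∑ (λ i → shift t ((f ↓ i) *S (g ↓ (x ℕ.∸ i))) a) (upTo (suc x))
    ≡⟨ shift-suc-*S t f g x a ⟩
  shift (suc t) (f *S g) (x ∷ a) ∎

*S-shiftˡ : ∀ {k} (t : Fin k) (f g : Series k) → shift t f *S g ≈ shift t (f *S g)
*S-shiftˡ zero f g (zero ∷ a) =
  trans (*S-cons (shift zero f) g 0 a) (cong (ℤ._+ + 0) (*S-zeroˡ (g ↓ 0) (λ _ → refl) a))
*S-shiftˡ zero f g (suc x ∷ a) = begin
  (shift zero f *S g) (suc x ∷ a)                ≡⟨ *S-cons (shift zero f) g (suc x) a ⟩
  ∑ term (upTo (suc (suc x)))                 ≡⟨ ∑-upTo-first term (suc x) ⟩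
  term 0 ℤ.+ ∑ (term ∘ suc) (upTo (suc x))    ≡⟨ cong (ℤ._+ ∑ (term ∘ suc) (upTo (suc x)))
                                                   (*S-zeroˡ (g ↓ suc x) (λ _ → refl) a) ⟩
  + 0 ℤ.+ ∑ (term ∘ suc) (upTo (suc x))       ≡⟨ ℤP.+-identityˡ _ ⟩
  ∑ (term ∘ suc) (upTo (suc x))               ≡⟨ *S-cons f g x a ⟨
  (f *S g) (x ∷ a)                            ∎
  where
  term : ℕ → ℤ
  term i = ((shift zero f ↓ i) *S (g ↓ (suc x ℕ.∸ i))) a
*S-shiftˡ (suc t) f g (x ∷ a) = begin
  (shift (suc t) f *S g) (x ∷ a)
    ≡⟨ *S-cons (shift (suc t) f) g x a ⟩
  ∑ (λ i → ((shift (suc t) f ↓ i) *S (g ↓ (x ℕ.∸ i))) a) (upTo (suc x))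
    ≡⟨ ∑-cong (λ i → trans (*S-cong {g = g ↓ (x ℕ.∸ i)} (shift-suc t f i) (λ _ → refl) a)
                           (*S-shiftˡ t (f ↓ i) (g ↓ (x ℕ.∸ i)) a)) (upTo (suc x)) ⟩
  ∑ (λ i → shift t ((f ↓ i) *S (g ↓ (x ℕ.∸ i))) a) (upTo (suc x))
    ≡⟨ shift-suc-*S t f g x a ⟩
  shift (suc t) (f *S g) (x ∷ a) ∎

varS≈shift-one : ∀ {k} (t : Fin k) → varS t ≈ shift t oneS
varS≈shift-one zero    (zero        ∷ a) = refl
varS≈shift-one zero    (suc zero    ∷ a) = refl
varS≈shift-one zero    (suc (suc x) ∷ a) = refl
varS≈shift-one (suc t) (zero        ∷ a) = trans (varS≈shift-one t a) (sym (shift-suc t oneS 0 a))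
varS≈shift-one (suc t) (suc x       ∷ a) with dec t a
... | just b  = refl
... | nothing = refl

-- The factors of the denominator

mul1+ : ∀ {k} → Fin k → Series k → Series k
mul1+ t f = f +S shift t f

mul1+-cong : ∀ {k} (t : Fin k) {f g : Series k} → f ≈ g → mul1+ t f ≈ mul1+ t g
mul1+-cong t e a = cong₂ ℤ._+_ (e a) (shift-cong t e a)

1+var-*S : ∀ {k} (t : Fin k) (f : Series k) → (oneS +S varS t) *S f ≈ mul1+ t f
1+var-*S t f a = begin
  ((oneS +S varS t) *S f) a       ≡⟨ *S-distribʳ f oneS (varS t) a ⟩
  (oneS *S f) a ℤ.+ (varS t *S f) a ≡⟨ cong₂ ℤ._+_ (*S-oneˡ f a)
      (trans (*S-cong {g = f} (varS≈shift-one t) (λ _ → refl) a)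
      (trans (*S-shiftˡ t oneS f a) (shift-cong t (*S-oneˡ f) a))) ⟩
  mul1+ t f a                     ∎

*S-mul1+ʳ : ∀ {k} (t : Fin k) (f g : Series k) → f *S mul1+ t g ≈ mul1+ t (f *S g)
*S-mul1+ʳ t f g a = trans (*S-distribˡ f g (shift t g) a) (cong (ℤ._+_ ((f *S g) a)) (*S-shiftʳ t f g a))

*S-mul1+ˡ : ∀ {k} (t : Fin k) (f g : Series k) → mul1+ t f *S g ≈ mul1+ t (f *S g)
*S-mul1+ˡ t f g a = trans (*S-distribʳ g f (shift t f) a) (cong (ℤ._+_ ((f *S g) a)) (*S-shiftˡ t f g a))

1-vars : ∀ {k} → Series k
1-vars {k} = oneS +S (-S List.foldr _+S_ (λ _ → + 0) (List.map varS (allFin k)))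

foldr-+S : ∀ {k} (g : Fin k → Series k) ts a →
           List.foldr _+S_ (λ _ → + 0) (List.map g ts) a ≡ ∑ (λ t → g t a) ts
foldr-+S g []       a = refl
foldr-+S g (t ∷ ts) a = cong (ℤ._+_ (g t a)) (foldr-+S g ts a)

*S-foldr-+S : ∀ {k} (f : Series k) (g : Fin k → Series k) ts →
  f *S List.foldr _+S_ (λ _ → + 0) (List.map g ts) ≈ λ a → ∑ (λ t → (f *S g t) a) ts
*S-foldr-+S f g []       a = *S-zeroʳ f (λ _ → refl) a
*S-foldr-+S f g (t ∷ ts) a =
  trans (*S-distribˡ f (g t) (List.foldr _+S_ (λ _ → + 0) (List.map g ts)) a)
        (cong (ℤ._+_ ((f *S g t) a)) (*S-foldr-+S f g ts a))

-- This is how an equation `f *S 1-vars ≈ oneS` is read as the recurrence f(a) = Σ_t f(a - e_t) for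
-- nonzero a.
*S-1-vars : ∀ {k} (f : Series k) a → (f *S 1-vars) a ≡ f a ℤ.- ∑ (λ t → shift t f a) (allFin k)
*S-1-vars {k} f a = begin
  (f *S 1-vars) a
    ≡⟨ *S-distribˡ f oneS (-S vars) a ⟩
  (f *S oneS) a ℤ.+ (f *S (-S vars)) a
    ≡⟨ cong₂ ℤ._+_ (*S-oneʳ f a) (*S-neg f vars a) ⟩
  f a ℤ.- (f *S vars) a
    ≡⟨ cong (λ z → f a ℤ.- z) (*S-foldr-+S f varS (allFin k) a) ⟩
  f a ℤ.- ∑ (λ t → (f *S varS t) a) (allFin k)
    ≡⟨ cong (λ z → f a ℤ.- z) (∑-cong mul-var (allFin k)) ⟩
  f a ℤ.- ∑ (λ t → shift t f a) (allFin k) ∎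
  where
  vars : Series k
  vars = List.foldr _+S_ (λ _ → + 0) (List.map varS (allFin k))
  mul-var : ∀ t → (f *S varS t) a ≡ shift t f a
  mul-var t = trans (*S-cong {f = f} (λ _ → refl) (varS≈shift-one t) a)
             (trans (*S-shiftʳ t f oneS a) (shift-cong t (*S-oneʳ f) a))

mulAll : ∀ {k} → Series k → List (Fin k) → Series k
mulAll = List.foldr mul1+

mulAll-cong : ∀ {k} {f g : Series k} → f ≈ g → ∀ ts → mulAll f ts ≈ mulAll g ts
mulAll-cong e []       = e
mulAll-cong e (t ∷ ts) = mul1+-cong t (mulAll-cong e ts)

foldr-*S : ∀ {k} (g : Series k) ts →
  List.foldr _*S_ g (List.map (λ t → oneS +S varS t) ts) ≈ mulAll g ts
foldr-*S g []       a = refl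
foldr-*S g (t ∷ ts) a = trans (1+var-*S t (List.foldr _*S_ g (List.map (λ t → oneS +S varS t) ts)) a)
        (mul1+-cong t (foldr-*S g ts) a)

*S-mulAll : ∀ {k} (f g : Series k) ts → f *S mulAll g ts ≈ mulAll (f *S g) ts
*S-mulAll f g []       a = refl
*S-mulAll f g (t ∷ ts) a = trans (*S-mul1+ʳ t f (mulAll g ts) a) (mul1+-cong t (*S-mulAll f g ts) a)

firsts : (k j : ℕ) → List (Fin k)
firsts k j = filter (λ t → toℕ t ℕ.<? j) (allFin k)

filter-map-suc : ∀ {k} j (ts : List (Fin k)) →
  filter (λ t → toℕ t ℕ.<? suc j) (List.map suc ts) ≡ List.map suc (filter (λ t → toℕ t ℕ.<? j) ts)
filter-map-suc j []       = refl
filter-map-suc j (t ∷ ts) with toℕ t ℕ.<? j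
... | yes p rewrite dec-true (suc (toℕ t) ℕ.<? suc j) (s≤s p)
  = cong (suc t ∷_) (filter-map-suc j ts)
... | no ¬p rewrite dec-false (suc (toℕ t) ℕ.<? suc j) (¬p ∘ ℕ.s≤s⁻¹)
  = filter-map-suc j ts

firsts-suc-suc : ∀ k j → firsts (suc k) (suc j) ≡ zero ∷ List.map suc (firsts k j)
firsts-suc-suc k j = cong (zero ∷_)
  (trans (cong (filter (λ t → toℕ t ℕ.<? suc j)) (sym (ListP.map-tabulate (λ t → t) suc)))
         (filter-map-suc j (allFin k)))

firsts-zero : ∀ k → firsts k 0 ≡ []
firsts-zero k = ListP.filter-none _ (All.universal (λ _ ()) (allFin k))

-- In `mulAll` the last factor is the innermost one, next to the series of counts, and it is the one
-- that telescoping has to absorb first. Hence the list is split at its end.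
firsts-snoc : ∀ {k} (t : Fin k) → firsts k (suc (toℕ t)) ≡ firsts k (toℕ t) ++ t ∷ []
firsts-snoc {suc k} zero    = trans (firsts-suc-suc k 0)
  (trans (cong (λ ts → zero ∷ List.map suc ts) (firsts-zero k))
         (cong (_++ zero ∷ []) (sym (firsts-zero (suc k)))))
firsts-snoc {suc k} (suc t) = begin
  firsts (suc k) (suc (suc (toℕ t)))                 ≡⟨ firsts-suc-suc k _ ⟩
  zero ∷ List.map suc (firsts k (suc (toℕ t)))       ≡⟨ cong (λ ts → zero ∷ List.map suc ts) (firsts-snoc t) ⟩
  zero ∷ List.map suc (firsts k (toℕ t) ++ t ∷ [])   ≡⟨ cong (zero ∷_) (ListP.map-++ suc (firsts k (toℕ t)) _) ⟩
  (zero ∷ List.map suc (firsts k (toℕ t))) ++ suc t ∷ [] ≡⟨ cong (_++ suc t ∷ []) (firsts-suc-suc k (toℕ t)) ⟨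
  firsts (suc k) (suc (toℕ t)) ++ suc t ∷ []         ∎

denom≈mulAll : ∀ k j → denom k j ≈ mulAll 1-vars (firsts k j)
denom≈mulAll k j = foldr-*S 1-vars (firsts k j)

-- Since multiplication by 1 + x_{j+1} may be moved onto the left factor, it turns F (j+1) into F j.
telescope : ∀ {k} (F : ℕ → Series k) → (∀ t → mul1+ t (F (suc (toℕ t))) ≈ F (toℕ t)) →
            F 0 *S 1-vars ≈ oneS → ∀ j → j ≤ k → F j *S denom k j ≈ oneS
telescope {k} F step base j j≤k a =
  trans (*S-cong {f = F j} (λ _ → refl) (denom≈mulAll k j) a)
        (trans (*S-mulAll (F j) 1-vars (firsts k j) a) (go j j≤k a))
  where
  go : ∀ j → j ≤ k → mulAll (F j *S 1-vars) (firsts k j) ≈ oneS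
  go zero    _ a rewrite firsts-zero k = base a
  go (suc j) j<k a = begin
    mulAll (F (suc j) *S 1-vars) (firsts k (suc j)) a
      ≡⟨ cong (λ m → mulAll (F (suc m) *S 1-vars) (firsts k (suc m)) a) toℕt≡j ⟨
    mulAll (F (suc (toℕ t)) *S 1-vars) (firsts k (suc (toℕ t))) a
      ≡⟨ cong (λ ts → mulAll (F (suc (toℕ t)) *S 1-vars) ts a) (firsts-snoc t) ⟩
    mulAll (F (suc (toℕ t)) *S 1-vars) (firsts k (toℕ t) ++ t ∷ []) a
      ≡⟨ cong (λ g → g a) (ListP.foldr-++ mul1+ _ (firsts k (toℕ t)) _) ⟩
    mulAll (mul1+ t (F (suc (toℕ t)) *S 1-vars)) (firsts k (toℕ t)) a
      ≡⟨ mulAll-cong (λ b → trans (sym (*S-mul1+ˡ t (F (suc (toℕ t))) 1-vars b))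
                                  (*S-cong {g = 1-vars} (step t) (λ _ → refl) b)) (firsts k (toℕ t)) a ⟩
    mulAll (F (toℕ t) *S 1-vars) (firsts k (toℕ t)) a
      ≡⟨ cong (λ m → mulAll (F m *S 1-vars) (firsts k m) a) toℕt≡j ⟩
    mulAll (F j *S 1-vars) (firsts k j) a
      ≡⟨ go j (ℕP.<⇒≤ j<k) a ⟩
    oneS a ∎
    where
    t : Fin k
    t = Fin.fromℕ< j<k
    toℕt≡j : toℕ t ≡ j
    toℕt≡j = FinP.toℕ-fromℕ< j<k

-- Uniqueness of the inverse series

dec-zeroVec : ∀ {k} (t : Fin k) → dec t zeroVec ≡ nothing
dec-zeroVec zero    = refl
dec-zeroVec (suc t) rewrite dec-zeroVec t = refl

shift-zeroVec : ∀ {k} (t : Fin k) f → shift t f zeroVec ≡ + 0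
shift-zeroVec t f rewrite dec-zeroVec t = refl

sum-zeroVec : ∀ k → Vec.sum (zeroVec {k}) ≡ 0
sum-zeroVec zero    = refl
sum-zeroVec (suc k) = sum-zeroVec k

oneS-zeroVec : ∀ {k} → oneS {k} zeroVec ≡ + 1
oneS-zeroVec {zero}  = refl
oneS-zeroVec {suc k} = oneS-zeroVec {k}

oneS-nonzero : ∀ {k} {a : Vec ℕ k} → a ≢ zeroVec → oneS a ≡ + 0
oneS-nonzero {a = a} a≢0 with a ≟v zeroVec
... | yes a≡0 = ⊥-elim (a≢0 a≡0)
... | no  _   = refl

1-vars-zeroVec : ∀ {k} → 1-vars {k} zeroVec ≡ + 1
1-vars-zeroVec {k} = cong₂ (λ x y → x ℤ.- y) (oneS-zeroVec {k})
  (trans (foldr-+S varS (allFin k) zeroVec)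
         (∑-zero (λ t → trans (varS≈shift-one t zeroVec) (shift-zeroVec t oneS)) (allFin k)))

mulAll-zeroVec : ∀ {k} (f : Series k) ts → mulAll f ts zeroVec ≡ f zeroVec
mulAll-zeroVec f []       = refl
mulAll-zeroVec f (t ∷ ts) =
  trans (cong₂ ℤ._+_ (mulAll-zeroVec f ts) (shift-zeroVec t (mulAll f ts))) (ℤP.+-identityʳ _)

denom-zeroVec : ∀ k j → denom k j zeroVec ≡ + 1
denom-zeroVec k j =
  trans (denom≈mulAll k j zeroVec) (trans (mulAll-zeroVec 1-vars (firsts k j)) (1-vars-zeroVec {k}))

-- The enumeration is lexicographic, so `a` comes last. The drop in total degree of all other
-- entries is what lets the fuel of `invFuel` decrease.
below-snoc : ∀ {k} (a : Vec ℕ k) →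
  ∃ λ bs → below a ≡ bs ++ a ∷ [] × All (λ b → Vec.sum b < Vec.sum a) bs
below-snoc []      = [] , refl , []
below-snoc (x ∷ a) with below-snoc a
... | bs , eq , bs<a = cs ++ List.map (x ∷_) bs , eq'
    , AllP.++⁺ cs<xa (AllP.map⁺ (All.map (ℕP.+-monoʳ-< x) bs<a))
  where
  f : ℕ → List (Vec ℕ _)
  f i = List.map (i ∷_) (below a)
  cs : List (Vec ℕ _)
  cs = concatMap f (upTo x)
  eq' : below (x ∷ a) ≡ (cs ++ List.map (x ∷_) bs) ++ (x ∷ a) ∷ []
  eq' = begin
    concatMap f (upTo (suc x))       ≡⟨ cong (concatMap f) (ListP.upTo-∷ʳ x) ⟨
    concatMap f (upTo x ++ x ∷ [])   ≡⟨ ListP.concatMap-++ f (upTo x) (x ∷ []) ⟩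
    cs ++ (f x ++ [])                ≡⟨ cong (cs ++_) (ListP.++-identityʳ (f x)) ⟩
    cs ++ f x                        ≡⟨ cong (λ l → cs ++ List.map (x ∷_) l) eq ⟩
    cs ++ List.map (x ∷_) (bs ++ a ∷ []) ≡⟨ cong (cs ++_) (ListP.map-++ (x ∷_) bs (a ∷ [])) ⟩
    cs ++ (List.map (x ∷_) bs ++ (x ∷ a) ∷ []) ≡⟨ ListP.++-assoc cs _ _ ⟨
    (cs ++ List.map (x ∷_) bs) ++ (x ∷ a) ∷ [] ∎
  below≤ : All (λ b → Vec.sum b ≤ Vec.sum a) (below a)
  below≤ = subst (All _) (sym eq) (AllP.++⁺ (All.map ℕP.<⇒≤ bs<a) (ℕP.≤-refl ∷ []))
  cs<xa : All (λ b → Vec.sum b < x ℕ.+ Vec.sum a) cs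
  cs<xa = AllP.concat⁺ (AllP.map⁺ (All.map
    (λ i<x → AllP.map⁺ (All.map (ℕP.+-mono-<-≤ i<x) below≤)) (AllP.all-upTo x)))

zipWith-∸-self : ∀ {k} (a : Vec ℕ k) → zipWith ℕ._∸_ a a ≡ zeroVec
zipWith-∸-self []      = refl
zipWith-∸-self (x ∷ a) = cong₂ _∷_ (ℕP.n∸n≡0 x) (zipWith-∸-self a)

∑-cong-All : ∀ {A : Set} {h h' : A → ℤ} {xs} → All (λ x → h x ≡ h' x) xs → ∑ h xs ≡ ∑ h' xs
∑-cong-All []       = refl
∑-cong-All (e ∷ es) = cong₂ ℤ._+_ e (∑-cong-All es)

-- Since Q has constant term 1, the last summand of (g Q)(a) is g(a) itself. Solving for it shows
-- that `g` obeys the recursion that defines `invFuel`.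
invFuel-unique : ∀ {k} (Q g : Series k) → Q zeroVec ≡ + 1 → g *S Q ≈ oneS →
                 ∀ fuel a → Vec.sum a < fuel → invFuel fuel Q a ≡ g a
invFuel-unique {k} Q g Q0 gQ (suc fuel) a (s≤s a≤fuel) with below-snoc a
... | bs , eq , bs<a = result
  where
  term : Vec ℕ k → ℤ
  term b = g b ℤ.* Q (zipWith ℕ._∸_ a b)
  gQ-split : ∑ term bs ℤ.+ g a ≡ oneS a
  gQ-split = begin
    ∑ term bs ℤ.+ g a                ≡⟨ cong (ℤ._+_ (∑ term bs)) last ⟨
    ∑ term bs ℤ.+ ∑ term (a ∷ [])    ≡⟨ ∑-++ term bs (a ∷ []) ⟨
    ∑ term (bs ++ a ∷ [])            ≡⟨ cong (∑ term) eq ⟨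
    (g *S Q) a                       ≡⟨ gQ a ⟩
    oneS a                           ∎
    where
    last : ∑ term (a ∷ []) ≡ g a
    last rewrite zipWith-∸-self a | Q0 = trans (ℤP.+-identityʳ _) (ℤP.*-identityʳ (g a))
  filter-eq : filter (λ b → ¬? (b ≟v a)) (below a) ≡ bs
  filter-eq = begin
    filter P? (below a)             ≡⟨ cong (filter P?) eq ⟩
    filter P? (bs ++ a ∷ [])        ≡⟨ ListP.filter-++ P? bs (a ∷ []) ⟩
    filter P? bs ++ filter P? (a ∷ []) ≡⟨ cong₂ _++_
        (ListP.filter-all P? (All.map (λ { b<a refl → ℕP.<-irrefl refl b<a }) bs<a))
        (ListP.filter-reject P? (λ a≢a → a≢a refl)) ⟩
    bs ++ []                        ≡⟨ ListP.++-identityʳ bs ⟩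
    bs                              ∎
    where
    P? = λ (b : Vec ℕ k) → ¬? (b ≟v a)
  result : invFuel (suc fuel) Q a ≡ g a
  result with a ≟v zeroVec
  -- Here `bs` is empty, because its entries would need a sum below 0.
  ... | yes refl = begin
    + 1               ≡⟨ oneS-zeroVec {k} ⟨
    oneS (zeroVec {k}) ≡⟨ gQ-split ⟨
    ∑ term bs ℤ.+ g a ≡⟨ cong (λ l → ∑ term l ℤ.+ g a) (empty bs<a) ⟩
    + 0 ℤ.+ g a       ≡⟨ ℤP.+-identityˡ (g a) ⟩
    g a               ∎
    where
    empty : ∀ {cs} → All (λ b → Vec.sum b < Vec.sum (zeroVec {k})) cs → cs ≡ []
    empty []        = refl
    empty {b ∷ _} (b<0 ∷ _) = ⊥-elim (ℕP.n≮0 (subst (Vec.sum b <_) (sum-zeroVec k) b<0))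
  ... | no a≢0 = begin
    - ∑ (λ b → invFuel fuel Q b ℤ.* Q (zipWith ℕ._∸_ a b)) (filter (λ b → ¬? (b ≟v a)) (below a))
      ≡⟨ cong (λ l → - ∑ (λ b → invFuel fuel Q b ℤ.* Q (zipWith ℕ._∸_ a b)) l) filter-eq ⟩
    - ∑ (λ b → invFuel fuel Q b ℤ.* Q (zipWith ℕ._∸_ a b)) bs
      ≡⟨ cong -_ (∑-cong-All (All.map (λ {b} b<a → cong (ℤ._* Q (zipWith ℕ._∸_ a b))
           (invFuel-unique Q g Q0 gQ fuel b (ℕP.<-≤-trans b<a a≤fuel))) bs<a)) ⟩
    - ∑ term bs
      ≡⟨ ℤP.+-identityʳ _ ⟨
    - ∑ term bs ℤ.+ + 0
      ≡⟨ cong (ℤ._+_ (- ∑ term bs)) (trans gQ-split (oneS-nonzero a≢0)) ⟨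
    - ∑ term bs ℤ.+ (∑ term bs ℤ.+ g a)
      ≡⟨ ℤP.+-assoc (- ∑ term bs) _ _ ⟨
    (- ∑ term bs ℤ.+ ∑ term bs) ℤ.+ g a
      ≡⟨ cong (ℤ._+ g a) (ℤP.+-inverseˡ (∑ term bs)) ⟩
    + 0 ℤ.+ g a
      ≡⟨ ℤP.+-identityˡ (g a) ⟩
    g a ∎

inverseS-unique : ∀ {k} (Q g : Series k) → Q zeroVec ≡ + 1 → g *S Q ≈ oneS → inverseS Q ≈ g
inverseS-unique Q g Q0 gQ a = invFuel-unique Q g Q0 gQ (suc (Vec.sum a)) a ℕP.≤-refl

-- Comparing cardinalities of finite lists

lookup-injective : ∀ {A : Set} {xs : List A} → Unique xs → ∀ i j →
                   List.lookup xs i ≡ List.lookup xs j → i ≡ j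
lookup-injective (x∉ ∷ u) zero    zero    e = refl
lookup-injective (x∉ ∷ u) zero    (suc j) e = ⊥-elim (All.lookup x∉ (∈P.∈-lookup j) e)
lookup-injective (x∉ ∷ u) (suc i) zero    e = ⊥-elim (All.lookup x∉ (∈P.∈-lookup i) (sym e))
lookup-injective (x∉ ∷ u) (suc i) (suc j) e = cong suc (lookup-injective u i j e)

-- The index in `ys` of a chosen partner is an injective map of `Fin` types. A relation is
-- convenient because the place of an insertion is only known to exist.
length-≤ : ∀ {A B : Set} (R : A → B → Set) {xs ys} → Unique xs →
           (∀ {x} → x ∈ xs → ∃ λ y → y ∈ ys × R x y) →
           (∀ {x x' y} → x ∈ xs → x' ∈ xs → R x y → R x' y → x ≡ x') →
           length xs ≤ length ys
length-≤ R {xs} {ys} uniq total inj = FinP.injective⇒≤ {f = f} f-injective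
  where
  image : ∀ i → ∃ λ y → y ∈ ys × R (List.lookup xs i) y
  image i = total (∈P.∈-lookup i)
  f : Fin (length xs) → Fin (length ys)
  f i = Any.index (proj₁ (proj₂ (image i)))
  f-injective : ∀ {i j} → f i ≡ f j → i ≡ j
  f-injective {i} {j} e with image i | image j
  ... | y , y∈ , r | y' , y'∈ , r' = lookup-injective uniq i j
    (inj (∈P.∈-lookup i) (∈P.∈-lookup j) r
      (subst (R _) (trans (AnyP.lookup-index y'∈)
        (trans (cong (List.lookup ys) (sym e)) (sym (AnyP.lookup-index y∈)))) r'))

length-≡ : ∀ {A B : Set} (R : A → B → Set) {xs ys} → Unique xs → Unique ys →
           (∀ {x} → x ∈ xs → ∃ λ y → y ∈ ys × R x y) →
           (∀ {y} → y ∈ ys → ∃ λ x → x ∈ xs × R x y) →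
           (∀ {x x' y} → x ∈ xs → x' ∈ xs → R x y → R x' y → x ≡ x') →
           (∀ {x y y'} → x ∈ xs → R x y → R x y' → y ≡ y') →
           length xs ≡ length ys
length-≡ {A} {B} R {xs} {ys} ux uy total surj inj func = ℕP.≤-antisym (length-≤ R ux total inj)
  (length-≤ S uy (λ y∈ → let x , x∈ , r = surj y∈ in x , x∈ , x∈ , r)
               (λ _ _ (x∈ , r) (_ , r') → func x∈ r r'))
  where
  -- The converse relation carries `x ∈ xs` along, because `func` asks for the membership of the
  -- source.
  S : B → A → Set
  S y x = x ∈ xs × R x y

length-filter-⊎ : ∀ {A : Set} {P Q R : A → Set} (P? : ∀ x → Dec (P x)) (Q? : ∀ x → Dec (Q x))
  (R? : ∀ x → Dec (R x)) → (∀ {x} → P x → Q x ⊎ R x) → (∀ {x} → Q x → P x) → (∀ {x} → R x → P x) →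
  (∀ {x} → Q x → ¬ R x) → ∀ xs → length (filter P? xs) ≡ length (filter Q? xs) + length (filter R? xs)
length-filter-⊎ P? Q? R? split q⇒p r⇒p disj [] = refl
length-filter-⊎ P? Q? R? split q⇒p r⇒p disj (x ∷ xs)
  with ih ← length-filter-⊎ P? Q? R? split q⇒p r⇒p disj xs | P? x | Q? x | R? x
... | yes p | yes q | yes r = ⊥-elim (disj q r)
... | yes p | yes q | no ¬r = cong suc ih
... | yes p | no ¬q | yes r = trans (cong suc ih) (sym (ℕP.+-suc _ _))
... | no ¬p | yes q | _     = ⊥-elim (¬p (q⇒p q))
... | no ¬p | _     | yes r = ⊥-elim (¬p (r⇒p r))
... | no ¬p | no ¬q | no ¬r = ih
... | yes p | no ¬q | no ¬r with split p
...   | inj₁ q = ⊥-elim (¬q q)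
...   | inj₂ r = ⊥-elim (¬r r)

concatMap-unique : ∀ {A B : Set} (f : A → List B) → (∀ x → Unique (f x)) →
  (∀ {x x' y} → y ∈ f x → y ∈ f x' → x ≡ x') → ∀ {xs} → Unique xs → Unique (concatMap f xs)
concatMap-unique f uf sep {xs} u = UniqueP.concat⁺ (AllP.map⁺ (All.universal uf xs))
  (AllPairsP.map⁺ (AllPairs.map (λ x≢x' {_} (y∈ , y∈') → x≢x' (sep y∈ y∈')) u))

length-concatMap : ∀ {A B : Set} (f : A → List B) xs →
                   + length (concatMap f xs) ≡ ∑ (λ x → + length (f x)) xs
length-concatMap f []       = refl
length-concatMap f (x ∷ xs) =
  trans (cong +_ (ListP.length-++ (f x))) (cong (ℤ._+_ (+ length (f x))) (length-concatMap f xs))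

allVecs-complete : ∀ {m n} (v : Vec (Fin n) m) → v ∈ allVecs m n
allVecs-complete []      = here refl
allVecs-complete (x ∷ v) =
  ∈P.∈-concatMap⁺ _ (lose (allVecs-complete v) (∈P.∈-map⁺ (_∷ v) (∈P.∈-allFin x)))

allVecs-unique : ∀ m n → Unique (allVecs m n)
allVecs-unique zero    n = [] ∷ []
allVecs-unique (suc m) n = concatMap-unique _
  (λ v → UniqueP.map⁺ VecP.∷-injectiveˡ (UniqueP.allFin⁺ n)) sep (allVecs-unique m n)
  where
  sep : ∀ {v v' w} → w ∈ List.map (_∷ v) (allFin n) → w ∈ List.map (_∷ v') (allFin n) → v ≡ v'
  sep w∈ w∈' with ∈P.∈-map⁻ _ w∈ | ∈P.∈-map⁻ _ w∈'
  ... | _ , _ , e | _ , _ , e' = VecP.∷-injectiveʳ (trans (sym e) e')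

-- Blocks

c-mono : ∀ {k} (a : Vec ℕ k) {m m'} → m ≤ m' → c a m ≤ c a m'
c-mono a       z≤n     = z≤n
c-mono []      (s≤s l) = z≤n
c-mono (x ∷ a) (s≤s l) = ℕP.+-monoʳ-≤ x (c-mono a l)

c≤sum : ∀ {k} (a : Vec ℕ k) m → c a m ≤ Vec.sum a
c≤sum a       zero    = z≤n
c≤sum []      (suc m) = z≤n
c≤sum (x ∷ a) (suc m) = ℕP.+-monoʳ-≤ x (c≤sum a m)

c-inc-≤ : ∀ {k} (t : Fin k) b {m} → m ≤ toℕ t → c (inc t b) m ≡ c b m
c-inc-≤ t       b       {zero}  _       = refl
c-inc-≤ (suc t) (x ∷ b) {suc m} (s≤s l) = cong (ℕ._+_ x) (c-inc-≤ t b l)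

c-inc-> : ∀ {k} (t : Fin k) b {m} → toℕ t < m → c (inc t b) m ≡ suc (c b m)
c-inc-> zero    (x ∷ b) (s≤s l) = refl
c-inc-> (suc t) (x ∷ b) (s≤s l) = trans (cong (ℕ._+_ x) (c-inc-> t b l)) (ℕP.+-suc x _)

sum-inc : ∀ {k} (t : Fin k) b → Vec.sum (inc t b) ≡ suc (Vec.sum b)
sum-inc zero    (x ∷ b) = refl
sum-inc (suc t) (x ∷ b) = trans (cong (ℕ._+_ x) (sum-inc t b)) (ℕP.+-suc x _)

c-dec-nothing : ∀ {k} (t : Fin k) a → dec t a ≡ nothing → c a (suc (toℕ t)) ≡ c a (toℕ t)
c-dec-nothing zero    (zero ∷ a) e = refl
c-dec-nothing (suc t) (x    ∷ a) e with dec t a in e'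
c-dec-nothing (suc t) (x    ∷ a) e | nothing = cong (ℕ._+_ x) (c-dec-nothing t a e')

block-exists : ∀ {k} (a : Vec ℕ k) {p} → p < Vec.sum a → ∃ λ t → InBlock a t p
block-exists (x ∷ a) {p} p<s with p ℕ.<? x
... | yes p<x = zero , z≤n , subst (p <_) (sym (ℕP.+-identityʳ x)) p<x
... | no  p≮x with ℕP.m≤n⇒∃[o]m+o≡n (ℕP.≮⇒≥ p≮x)
...   | q , refl with block-exists a (ℕP.+-cancelˡ-< x _ _ p<s)
...     | t , lo , hi = suc t , ℕP.+-monoʳ-≤ x lo , ℕP.+-monoʳ-< x hi

block-unique : ∀ {k} (a : Vec ℕ k) {s t p} → InBlock a s p → InBlock a t p → s ≡ t
block-unique a {s} {t} (lo , hi) (lo' , hi') with ℕP.<-cmp (toℕ s) (toℕ t)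
... | tri< s<t _ _ = ⊥-elim (ℕP.<-irrefl refl (ℕP.<-≤-trans hi (ℕP.≤-trans (c-mono a s<t) lo')))
... | tri≈ _ e _   = FinP.toℕ-injective e
... | tri> _ _ t<s = ⊥-elim (ℕP.<-irrefl refl (ℕP.<-≤-trans hi' (ℕP.≤-trans (c-mono a t<s) lo)))

-- Inserting a value into a permutation

toℕ-punchIn-< : ∀ {n} (p : Fin (suc n)) i → toℕ i < toℕ p → toℕ (punchIn p i) ≡ toℕ i
toℕ-punchIn-< (suc p) zero    l       = refl
toℕ-punchIn-< (suc p) (suc i) (s≤s l) = cong suc (toℕ-punchIn-< p i l)

toℕ-punchIn-≥ : ∀ {n} (p : Fin (suc n)) i → toℕ p ≤ toℕ i → toℕ (punchIn p i) ≡ suc (toℕ i)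
toℕ-punchIn-≥ zero    i       l       = refl
toℕ-punchIn-≥ (suc p) (suc i) (s≤s l) = cong suc (toℕ-punchIn-≥ p i l)

punchIn-mono-< : ∀ {n} (p : Fin (suc n)) i j → toℕ i < toℕ j → toℕ (punchIn p i) < toℕ (punchIn p j)
punchIn-mono-< p i j l = ℕP.≰⇒> (ℕP.<⇒≱ l ∘ FinP.punchIn-cancel-≤ p j i)

punchIn-cancel-< : ∀ {n} (p : Fin (suc n)) i j → toℕ (punchIn p i) < toℕ (punchIn p j) → toℕ i < toℕ j
punchIn-cancel-< p i j l = ℕP.≰⇒> (ℕP.<⇒≱ l ∘ FinP.punchIn-mono-≤ p j i)

punchIn-above⁺ : ∀ {n} (p : Fin (suc n)) i → toℕ p ≤ toℕ i → toℕ p < toℕ (punchIn p i)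
punchIn-above⁺ p i l = subst (toℕ p <_) (sym (toℕ-punchIn-≥ p i l)) (s≤s l)

punchIn-below⁺ : ∀ {n} (p : Fin (suc n)) i → toℕ i < toℕ p → toℕ (punchIn p i) < toℕ p
punchIn-below⁺ p i l = subst (_< toℕ p) (sym (toℕ-punchIn-< p i l)) l

punchIn-above⁻ : ∀ {n} (p : Fin (suc n)) i → toℕ p < toℕ (punchIn p i) → toℕ p ≤ toℕ i
punchIn-above⁻ p i l = ℕP.≮⇒≥ (ℕP.<-asym l ∘ punchIn-below⁺ p i)

punchIn-below⁻ : ∀ {n} (p : Fin (suc n)) i → toℕ (punchIn p i) < toℕ p → toℕ i < toℕ p
punchIn-below⁻ p i l = ℕP.≰⇒> (ℕP.<-asym l ∘ punchIn-above⁺ p i)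

data PunchView {n} (p : Fin (suc n)) : Fin (suc n) → Set where
  at    : PunchView p p
  other : ∀ i → PunchView p (punchIn p i)

punchView : ∀ {n} (p q : Fin (suc n)) → PunchView p q
punchView p q with p FinP.≟ q
... | yes refl = at
... | no p≢q   = subst (PunchView p) (FinP.punchIn-punchOut p≢q) (other (punchOut p≢q))

-- Inverse to deleting the entry at `p` and standardising: positions from `p` on and values from `v`
-- on move up by one.
ins : ∀ {m n} → Fin (suc m) → Fin (suc n) → Vec (Fin n) m → Vec (Fin (suc n)) (suc m)
ins p v π = insertAt (Vec.map (punchIn v) π) p v

lookup-ins-at : ∀ {m n} (p : Fin (suc m)) (v : Fin (suc n)) π → lookup (ins p v π) p ≡ v
lookup-ins-at p v π = VecP.insertAt-lookup (Vec.map (punchIn v) π) p v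

lookup-ins : ∀ {m n} (p : Fin (suc m)) (v : Fin (suc n)) π i →
             lookup (ins p v π) (punchIn p i) ≡ punchIn v (lookup π i)
lookup-ins p v π i =
  trans (VecP.insertAt-punchIn (Vec.map (punchIn v) π) p v i) (VecP.lookup-map i (punchIn v) π)

ins-injective : ∀ {m n} (p : Fin (suc m)) (v : Fin (suc n)) {π π'} → ins p v π ≡ ins p v π' → π ≡ π'
ins-injective p v {π} {π'} e = Pointwise-≡⇒≡ (ext λ i → FinP.punchIn-injective v _ _
  (trans (sym (lookup-ins p v π i)) (trans (cong (λ σ → lookup σ (punchIn p i)) e) (lookup-ins p v π' i))))

-- By injectivity the value `v` occurs only at `p`, so `punchOut` applies to every other entry.
deletion : ∀ {n} (σ : Vec (Fin (suc n)) (suc n)) p v → IsPerm σ → lookup σ p ≡ v → ∃ λ π → σ ≡ ins p v π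
deletion {n} σ p v (inj , _) σp≡v = π , Pointwise-≡⇒≡ (ext same)
  where
  v≢ : ∀ i → v ≢ lookup σ (punchIn p i)
  v≢ i e = FinP.punchInᵢ≢i p i (inj _ _ (trans (sym e) (sym σp≡v)))
  π : Vec (Fin n) n
  π = tabulate (λ i → punchOut (v≢ i))
  same : ∀ q → lookup σ q ≡ lookup (ins p v π) q
  same q with punchView p q
  ... | at      = trans σp≡v (sym (lookup-ins-at p v π))
  ... | other i = sym (trans (lookup-ins p v π i)
    (trans (cong (punchIn v) (VecP.lookup∘tabulate _ i)) (FinP.punchIn-punchOut (v≢ i))))

isPerm-ins⁺ : ∀ {n} (p v : Fin (suc n)) {π} → IsPerm π → IsPerm (ins p v π)
isPerm-ins⁺ p v {π} (inj , surj) = inj' , surj'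
  where
  inj' : ∀ i j → lookup (ins p v π) i ≡ lookup (ins p v π) j → i ≡ j
  inj' i j e with punchView p i | punchView p j
  ... | at       | at       = refl
  ... | at       | other j' = ⊥-elim (FinP.punchInᵢ≢i v _
    (trans (sym (lookup-ins p v π j')) (trans (sym e) (lookup-ins-at p v π))))
  ... | other i' | at       = ⊥-elim (FinP.punchInᵢ≢i v _
    (trans (sym (lookup-ins p v π i')) (trans e (lookup-ins-at p v π))))
  ... | other i' | other j' = cong (punchIn p) (inj i' j' (FinP.punchIn-injective v _ _
    (trans (sym (lookup-ins p v π i')) (trans e (lookup-ins p v π j')))))
  surj' : ∀ y → ∃ λ i → lookup (ins p v π) i ≡ y
  surj' y with punchView v y
  ... | at       = p , lookup-ins-at p v π
  ... | other y' with surj y'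
  ...   | i , e = punchIn p i , trans (lookup-ins p v π i) (cong (punchIn v) e)

isPerm-ins⁻ : ∀ {n} (p v : Fin (suc n)) {π} → IsPerm (ins p v π) → IsPerm π
isPerm-ins⁻ p v {π} (inj , surj) = inj' , surj'
  where
  inj' : ∀ i j → lookup π i ≡ lookup π j → i ≡ j
  inj' i j e = FinP.punchIn-injective p i j (inj _ _
    (trans (lookup-ins p v π i) (trans (cong (punchIn v) e) (sym (lookup-ins p v π j)))))
  surj' : ∀ y → ∃ λ i → lookup π i ≡ y
  surj' y with surj (punchIn v y)
  ... | q , e with punchView p q
  ...   | at      = ⊥-elim (FinP.punchInᵢ≢i v y (trans (sym e) (lookup-ins-at p v π)))
  ...   | other i = i , FinP.punchIn-injective v _ _ (trans (sym (lookup-ins p v π i)) e)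

-- Unlike the condition on neighbours, this one is stable under insertion and deletion: `punchIn`
-- preserves the order of positions but not their adjacency.
Decreasing : ∀ {k n} → Vec ℕ k → Vec (Fin n) n → Set
Decreasing a π = ∀ t i i' → toℕ i < toℕ i' → InBlock a t (toℕ i) → InBlock a t (toℕ i') →
                 toℕ (lookup π i') < toℕ (lookup π i)

-- Induction on the distance; blocks are intervals, so the position just before `i'` is still in the
-- block.
descents⇒decreasing : ∀ {k n} (a : Vec ℕ k) (π : Vec (Fin n) n) → Descents a π → Decreasing a π
descents⇒decreasing {n = n} a π desc t i i' i<i' i∈ i'∈ with ℕP.m≤n⇒∃[o]m+o≡n i<i'
... | d , e = go d i' (trans (sym e) (cong suc (ℕP.+-comm (toℕ i) d))) i'∈
  where
  go : ∀ d i' → toℕ i' ≡ suc (d + toℕ i) → InBlock a t (toℕ i') → toℕ (lookup π i') < toℕ (lookup π i)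
  go zero    i' e i'∈ = desc i i' e (t , i∈ , i'∈)
  go (suc d) i' e i'∈ = ℕP.<-trans (desc m i' (trans e (cong suc (sym toℕm))) (t , m∈ , i'∈)) (go d m toℕm m∈)
    where
    m<i' : suc (d + toℕ i) < toℕ i'
    m<i' = subst (suc (d + toℕ i) <_) (sym e) ℕP.≤-refl
    m<n : suc (d + toℕ i) < n
    m<n = ℕP.<-trans m<i' (FinP.toℕ<n i')
    m : Fin n
    m = fromℕ< m<n
    toℕm : toℕ m ≡ suc (d + toℕ i)
    toℕm = FinP.toℕ-fromℕ< m<n
    m∈ : InBlock a t (toℕ m)
    m∈ rewrite toℕm = ℕP.≤-trans (proj₁ i∈) (ℕP.≤-trans (ℕP.m≤n+m (toℕ i) d) (ℕP.n≤1+n _))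
                    , ℕP.<-trans m<i' (proj₂ i'∈)

decreasing⇒descents : ∀ {k n} (a : Vec ℕ k) (π : Vec (Fin n) n) → Decreasing a π → Descents a π
decreasing⇒descents a π decr i i' e (t , i∈ , i'∈) =
  decr t i i' (subst (toℕ i <_) (sym e) ℕP.≤-refl) i∈ i'∈

module _ {k} (t : Fin k) (b : Vec ℕ k) {n} (p : Fin (suc n)) (p∈ : InBlock (inc t b) t (toℕ p)) where

  private
    lo : c b (toℕ t) ≤ toℕ p
    lo = subst (_≤ toℕ p) (c-inc-≤ t b ℕP.≤-refl) (proj₁ p∈)

    -- Equality is possible: a block of length l offers l + 1 places, one of them just past its old
    -- end.
    hi : toℕ p ≤ c b (suc (toℕ t))
    hi = ℕ.s≤s⁻¹ (subst (toℕ p <_) (c-inc-> t b ℕP.≤-refl) (proj₂ p∈))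

  -- A block bound moves up by one exactly when it lies after block `t`, a position exactly when it
  -- is at or past `p`. In the mixed cases, `lo` and `hi` separate bound from position where needed.
  -- Together with the converse this transports block membership, upper bounds by contraposition.
  c≤punchIn⁺ : ∀ m i → c b m ≤ toℕ i → c (inc t b) m ≤ toℕ (punchIn p i)
  c≤punchIn⁺ m i l with m ℕ.≤? toℕ t | toℕ i ℕ.<? toℕ p
  ... | yes m≤t | yes i<p rewrite c-inc-≤ t b m≤t | toℕ-punchIn-< p i i<p = l
  ... | yes m≤t | no  i≮p rewrite c-inc-≤ t b m≤t | toℕ-punchIn-≥ p i (ℕP.≮⇒≥ i≮p) = ℕP.m≤n⇒m≤1+n l
  ... | no  m≰t | yes i<p =
    ⊥-elim (ℕP.<-irrefl refl (ℕP.<-≤-trans i<p (ℕP.≤-trans hi (ℕP.≤-trans (c-mono b (ℕP.≰⇒> m≰t)) l))))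
  ... | no  m≰t | no  i≮p rewrite c-inc-> t b (ℕP.≰⇒> m≰t) | toℕ-punchIn-≥ p i (ℕP.≮⇒≥ i≮p) = s≤s l

  c≤punchIn⁻ : ∀ m i → c (inc t b) m ≤ toℕ (punchIn p i) → c b m ≤ toℕ i
  c≤punchIn⁻ m i l with m ℕ.≤? toℕ t | toℕ i ℕ.<? toℕ p
  ... | yes m≤t | yes i<p rewrite c-inc-≤ t b m≤t | toℕ-punchIn-< p i i<p = l
  ... | yes m≤t | no  i≮p = ℕP.≤-trans (c-mono b m≤t) (ℕP.≤-trans lo (ℕP.≮⇒≥ i≮p))
  ... | no  m≰t | yes i<p rewrite c-inc-> t b (ℕP.≰⇒> m≰t) | toℕ-punchIn-< p i i<p = ℕP.<⇒≤ l
  ... | no  m≰t | no  i≮p rewrite c-inc-> t b (ℕP.≰⇒> m≰t) | toℕ-punchIn-≥ p i (ℕP.≮⇒≥ i≮p) = ℕ.s≤s⁻¹ l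

  inBlock-punchIn⁺ : ∀ {s} i → InBlock b s (toℕ i) → InBlock (inc t b) s (toℕ (punchIn p i))
  inBlock-punchIn⁺ {s} i (l , h) =
    c≤punchIn⁺ (toℕ s) i l , ℕP.≰⇒> (ℕP.<⇒≱ h ∘ c≤punchIn⁻ (suc (toℕ s)) i)

  inBlock-punchIn⁻ : ∀ {s} i → InBlock (inc t b) s (toℕ (punchIn p i)) → InBlock b s (toℕ i)
  inBlock-punchIn⁻ {s} i (l , h) =
    c≤punchIn⁻ (toℕ s) i l , ℕP.≰⇒> (ℕP.<⇒≱ h ∘ c≤punchIn⁺ (suc (toℕ s)) i)

-- The condition is stated on the values before renumbering, hence the weak inequality: an old value
-- equal to `v` is raised above it.
Fits : ∀ {k n} → Fin k → Vec ℕ k → Fin (suc n) → Fin (suc n) → Vec (Fin n) n → Set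
Fits t b p v π = ∀ i → InBlock b t (toℕ i) →
  (toℕ i < toℕ p → toℕ v ≤ toℕ (lookup π i)) × (toℕ p ≤ toℕ i → toℕ (lookup π i) < toℕ v)

decreasing-ins⁺ : ∀ {k n} (t : Fin k) b (p v : Fin (suc n)) π → InBlock (inc t b) t (toℕ p) →
                  Decreasing b π → Fits t b p v π → Decreasing (inc t b) (ins p v π)
decreasing-ins⁺ t b p v π p∈ decr fits s q q' q<q' q∈ q'∈ with punchView p q | punchView p q'
... | at      | at       = ⊥-elim (ℕP.<-irrefl refl q<q')
... | at      | other i'
  rewrite lookup-ins-at p v π | lookup-ins p v π i' | block-unique (inc t b) {s} {t} q∈ p∈ =
  punchIn-below⁺ v _ (proj₂ (fits i' (inBlock-punchIn⁻ t b p p∈ i' q'∈)) (punchIn-above⁻ p i' q<q'))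
... | other i | at
  rewrite lookup-ins-at p v π | lookup-ins p v π i | block-unique (inc t b) {s} {t} q'∈ p∈ =
  punchIn-above⁺ v _ (proj₁ (fits i (inBlock-punchIn⁻ t b p p∈ i q∈)) (punchIn-below⁻ p i q<q'))
... | other i | other i' rewrite lookup-ins p v π i | lookup-ins p v π i' =
  punchIn-mono-< v _ _ (decr s i i' (punchIn-cancel-< p i i' q<q')
    (inBlock-punchIn⁻ t b p p∈ i q∈) (inBlock-punchIn⁻ t b p p∈ i' q'∈))

decreasing-ins⁻ : ∀ {k n} (t : Fin k) b (p v : Fin (suc n)) π → InBlock (inc t b) t (toℕ p) →
                  Decreasing (inc t b) (ins p v π) → Decreasing b π × Fits t b p v π
decreasing-ins⁻ {n = n} t b p v π p∈ decr = decr' , fits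
  where
  lift : ∀ {s} i → InBlock b s (toℕ i) → InBlock (inc t b) s (toℕ (punchIn p i))
  lift = inBlock-punchIn⁺ t b p p∈
  decr' : Decreasing b π
  decr' s i i' i<i' i∈ i'∈ = punchIn-cancel-< v _ _
    (subst₂ (λ x y → toℕ x < toℕ y) (lookup-ins p v π i') (lookup-ins p v π i)
      (decr s (punchIn p i) (punchIn p i') (punchIn-mono-< p i i' i<i') (lift i i∈) (lift i' i'∈)))
  fits : Fits t b p v π
  fits i i∈ =
      (λ i<p → punchIn-above⁻ v _ (subst₂ (λ x y → toℕ x < toℕ y) (lookup-ins-at p v π) (lookup-ins p v π i)
        (decr t (punchIn p i) p (punchIn-below⁺ p i i<p) (lift i i∈) p∈)))
    , (λ p≤i → punchIn-below⁻ v _ (subst₂ (λ x y → toℕ x < toℕ y) (lookup-ins p v π i) (lookup-ins-at p v π)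
        (decr t p (punchIn p i) (punchIn-above⁺ p i p≤i) p∈ (lift i i∈))))

-- The recurrences for the numbers |D_j(a)|

-- `InD` with the length freed from `Vec.sum a`: the sum of `inc t b` is a successor only up to a
-- proved equation.
InDₙ : ∀ {k n} → Vec ℕ k → ℕ → Vec (Fin n) n → Set
InDₙ a j π = IsPerm π × Descents a π × NoFixedIn a j π

inDₙ? : ∀ {k n} (a : Vec ℕ k) (j : ℕ) (π : Vec (Fin n) n) → Dec (InDₙ a j π)
inDₙ? a j π = isPerm? π ×-dec descents? a π ×-dec noFixedIn? a j π

listD : ∀ {k} → (n : ℕ) → Vec ℕ k → ℕ → List (Vec (Fin n) n)
listD n a j = filter (inDₙ? a j) (allVecs n n)

listD-unique : ∀ {k} n (a : Vec ℕ k) j → Unique (listD n a j)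
listD-unique n a j = UniqueP.filter⁺ (inDₙ? a j) (allVecs-unique n n)

∈-listD⁺ : ∀ {k n} {a : Vec ℕ k} {j π} → InDₙ a j π → π ∈ listD n a j
∈-listD⁺ {a = a} {j} {π} π∈ = ∈P.∈-filter⁺ (inDₙ? a j) (allVecs-complete π) π∈

∈-listD⁻ : ∀ {k n} {a : Vec ℕ k} {j π} → π ∈ listD n a j → InDₙ a j π
∈-listD⁻ {n = n} {a} {j} π∈ = proj₂ (∈P.∈-filter⁻ (inDₙ? a j) {xs = allVecs n n} π∈)

FixedIn : ∀ {k n} → Vec ℕ k → Fin k → Vec (Fin n) n → Set
FixedIn a t π = ∃ λ p → InBlock a t (toℕ p) × lookup π p ≡ p

fixedIn? : ∀ {k n} (a : Vec ℕ k) t (π : Vec (Fin n) n) → Dec (FixedIn a t π)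
fixedIn? a t π = FinP.any? (λ p → inBlock? a t (toℕ p) ×-dec (lookup π p FinP.≟ p))

noFixedIn-weaken : ∀ {k n} (a : Vec ℕ k) j (π : Vec (Fin n) n) → NoFixedIn a (suc j) π → NoFixedIn a j π
noFixedIn-weaken a j π nf p (s , s<j , p∈) = nf p (s , ℕP.m≤n⇒m≤1+n s<j , p∈)

noFixedIn-suc : ∀ {k n} (a : Vec ℕ k) t (π : Vec (Fin n) n) →
                NoFixedIn a (toℕ t) π → ¬ FixedIn a t π → NoFixedIn a (suc (toℕ t)) π
noFixedIn-suc a t π nf ¬fix p (s , s≤t , p∈) e with ℕP.m≤n⇒m<n∨m≡n (ℕ.s≤s⁻¹ s≤t)
... | inj₁ s<t = nf p (s , s<t , p∈) e
... | inj₂ s≡t = ¬fix (p , subst (λ t → InBlock a t (toℕ p)) (FinP.toℕ-injective s≡t) p∈ , e)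

-- In a decreasing block without fixed points the values exceed their positions up to some place and are
-- smaller from there on; this is the only place where a fixed point can be inserted.
crossing : ∀ {k n} (t : Fin k) b (π : Vec (Fin n) n) → c b (suc (toℕ t)) ≤ n →
           Decreasing b π → NoFixedIn b (suc (toℕ t)) π →
           ∃ λ p → InBlock (inc t b) t (toℕ p) × Fits t b p p π
crossing {n = n} t b π hi≤n decr nf with ℕP.m≤n⇒∃[o]m+o≡n (c-mono b (ℕP.n≤1+n (toℕ t)))
... | d , e = go d (c b (toℕ t)) e ℕP.≤-refl (λ i i∈ i<lo → ⊥-elim (ℕP.<⇒≱ i<lo (proj₁ i∈)))
  where
  hi : ℕ
  hi = c b (suc (toℕ t))
  insertable : ∀ m → c b (toℕ t) ≤ m → m ≤ hi →
    (∀ i → InBlock b t (toℕ i) → toℕ i < m → m ≤ toℕ (lookup π i)) →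
    (∀ i → InBlock b t (toℕ i) → m ≤ toℕ i → toℕ (lookup π i) < m) →
    ∃ λ p → InBlock (inc t b) t (toℕ p) × Fits t b p p π
  insertable m lo≤m m≤hi below above = p , p∈ , fits
    where
    m<1+n : m < suc n
    m<1+n = s≤s (ℕP.≤-trans m≤hi hi≤n)
    p : Fin (suc n)
    p = fromℕ< m<1+n
    p∈ : InBlock (inc t b) t (toℕ p)
    p∈ rewrite FinP.toℕ-fromℕ< m<1+n | c-inc-≤ t b (ℕP.≤-refl {toℕ t}) | c-inc-> t b (ℕP.≤-refl {suc (toℕ t)})
      = lo≤m , s≤s m≤hi
    fits : Fits t b p p π
    fits i i∈ rewrite FinP.toℕ-fromℕ< m<1+n = below i i∈ , above i i∈
  go : ∀ d m → m + d ≡ hi → c b (toℕ t) ≤ m →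
    (∀ i → InBlock b t (toℕ i) → toℕ i < m → m ≤ toℕ (lookup π i)) →
    ∃ λ p → InBlock (inc t b) t (toℕ p) × Fits t b p p π
  go zero    m e lo≤m below = insertable m lo≤m (ℕP.≤-reflexive m≡hi) below
    (λ i i∈ m≤i → ⊥-elim (ℕP.<⇒≱ (proj₂ i∈) (subst (_≤ toℕ i) m≡hi m≤i)))
    where
    m≡hi : m ≡ hi
    m≡hi = trans (sym (ℕP.+-identityʳ m)) e
  -- The entry at `m` decides. If it is below `m`, so are all later ones of the block and `m` is the
  -- place; if it is above `m`, so are all earlier ones and the search moves on. Here `suc d`
  -- positions of the block remain.
  go (suc d) m e lo≤m below = step (ℕP.<-cmp (toℕ (lookup π i₀)) m)
    where
    m<hi : m < hi
    m<hi = subst (m <_) e (ℕP.m<m+n m (s≤s z≤n))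
    m<n : m < n
    m<n = ℕP.<-≤-trans m<hi hi≤n
    i₀ : Fin n
    i₀ = fromℕ< m<n
    i₀≡m : toℕ i₀ ≡ m
    i₀≡m = FinP.toℕ-fromℕ< m<n
    i₀∈ : InBlock b t (toℕ i₀)
    i₀∈ rewrite i₀≡m = lo≤m , m<hi
    step : _ → ∃ λ p → InBlock (inc t b) t (toℕ p) × Fits t b p p π
    step (tri< π<m _ _) = insertable m lo≤m (ℕP.<⇒≤ m<hi) below above
      where
      above : ∀ i → InBlock b t (toℕ i) → m ≤ toℕ i → toℕ (lookup π i) < m
      above i i∈ m≤i with ℕP.m≤n⇒m<n∨m≡n m≤i
      ... | inj₁ m<i = ℕP.<-trans (decr t i₀ i (subst (_< toℕ i) (sym i₀≡m) m<i) i₀∈ i∈) π<m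
      ... | inj₂ m≡i rewrite FinP.toℕ-injective (trans i₀≡m m≡i) = π<m
    step (tri≈ _ π≡m _) =
      ⊥-elim (nf i₀ (t , ℕP.≤-refl , i₀∈) (FinP.toℕ-injective (trans π≡m (sym i₀≡m))))
    step (tri> _ _ m<π) = go d (suc m) (trans (sym (ℕP.+-suc m d)) e) (ℕP.m≤n⇒m≤1+n lo≤m) below'
      where
      below' : ∀ i → InBlock b t (toℕ i) → toℕ i < suc m → suc m ≤ toℕ (lookup π i)
      below' i i∈ (s≤s i≤m) with ℕP.m≤n⇒m<n∨m≡n i≤m
      ... | inj₁ i<m = ℕP.<-trans m<π (decr t i i₀ (subst (toℕ i <_) (sym i₀≡m) i<m) i∈ i₀∈)
      ... | inj₂ i≡m rewrite FinP.toℕ-injective (trans i₀≡m (sym i≡m)) = m<π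

-- Removing a fixed point from a block

module FixedPointRemoval {k} (t : Fin k) (b : Vec ℕ k) (n : ℕ) (sum≡n : Vec.sum b ≡ n) where

  a : Vec ℕ k
  a = inc t b

  OneFixed : Vec (Fin (suc n)) (suc n) → Set
  OneFixed σ = InDₙ a (toℕ t) σ × FixedIn a t σ

  oneFixed? : ∀ σ → Dec (OneFixed σ)
  oneFixed? σ = inDₙ? a (toℕ t) σ ×-dec fixedIn? a t σ

  -- The place `p` is determined from either side: by `σ` as its only fixed point in block `t`, by
  -- `π` as the only gap that accepts one.
  R : Vec (Fin (suc n)) (suc n) → Vec (Fin n) n → Set
  R σ π = ∃ λ p → InBlock a t (toℕ p) × σ ≡ ins p p π

  remove : ∀ {σ} → OneFixed σ → ∃ λ π → InDₙ b (suc (toℕ t)) π × R σ π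
  remove {σ} ((perm , desc , nf) , p , p∈ , σp≡p) with deletion σ p p perm σp≡p
  ... | π , refl = π , (isPerm-ins⁻ p p perm , decreasing⇒descents b π decr , nf') , p , p∈ , refl
    where
    decr-fits : Decreasing b π × Fits t b p p π
    decr-fits = decreasing-ins⁻ t b p p π p∈ (descents⇒decreasing a (ins p p π) desc)
    decr : Decreasing b π
    decr = proj₁ decr-fits
    ¬fixed : ¬ FixedIn b t π
    -- Left of `p` the block has values at least `p`, from `p` on values below `p`; neither allows a
    -- value equal to its position.
    ¬fixed (i , i∈ , πi≡i) with toℕ i ℕ.<? toℕ p
    ... | yes i<p = ℕP.<⇒≱ i<p (subst (λ x → toℕ p ≤ toℕ x) πi≡i (proj₁ (proj₂ decr-fits i i∈) i<p))
    ... | no  i≮p = i≮p (subst (λ x → toℕ x < toℕ p) πi≡i (proj₂ (proj₂ decr-fits i i∈) (ℕP.≮⇒≥ i≮p)))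
    nf' : NoFixedIn b (suc (toℕ t)) π
    nf' = noFixedIn-suc b t π
      (λ i (s , s<t , i∈) πi≡i → nf (punchIn p i) (s , s<t , inBlock-punchIn⁺ t b p p∈ i i∈)
        (trans (lookup-ins p p π i) (cong (punchIn p) πi≡i))) ¬fixed

  insert : ∀ {π} → InDₙ b (suc (toℕ t)) π → ∃ λ σ → OneFixed σ × R σ π
  insert {π} (perm , desc , nf) with crossing t b π (subst (c b (suc (toℕ t)) ≤_) sum≡n (c≤sum b (suc (toℕ t))))
                                       (descents⇒decreasing b π desc) nf
  ... | p , p∈ , fits = ins p p π
      , ((isPerm-ins⁺ p p perm
        , decreasing⇒descents a (ins p p π) (decreasing-ins⁺ t b p p π p∈ (descents⇒decreasing b π desc) fits)
        , nf')
        , p , p∈ , lookup-ins-at p p π)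
      , p , p∈ , refl
    where
    nf' : NoFixedIn a (toℕ t) (ins p p π)
    nf' q (s , s<t , q∈) σq≡q with punchView p q
    -- The inserted fixed point lies in block `t`, outside the blocks that must stay free of fixed
    -- points.
    ... | at      = ℕP.<-irrefl (cong toℕ (block-unique a {s} {t} q∈ p∈)) s<t
    ... | other i = nf i (s , ℕP.m≤n⇒m≤1+n s<t , inBlock-punchIn⁻ t b p p∈ i q∈)
                       (FinP.punchIn-injective p _ _ (trans (sym (lookup-ins p p π i)) σq≡q))

  -- If `p` is before `p'`, the old position numbered `p` lies in the block. Fitting at `p` forces
  -- its value below `p`, fitting at `p'` forces it to be at least `p'`.
  ¬two-places : ∀ {p p' π} → InBlock a t (toℕ p) → InBlock a t (toℕ p') →
                Fits t b p p π → Fits t b p' p' π → ¬ toℕ p < toℕ p'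
  ¬two-places {p} {p'} {π} p∈ p'∈ fits fits' p<p' = ℕP.<-irrefl refl
    (ℕP.<-trans (proj₂ (fits i i∈) (ℕP.≤-reflexive (sym i≡p)))
      (ℕP.<-≤-trans p<p' (proj₁ (fits' i i∈) (subst (_< toℕ p') (sym i≡p) p<p'))))
    where
    p<n : toℕ p < n
    p<n = ℕP.<-≤-trans p<p' (ℕ.s≤s⁻¹ (FinP.toℕ<n p'))
    i : Fin n
    i = fromℕ< p<n
    i≡p : toℕ i ≡ toℕ p
    i≡p = FinP.toℕ-fromℕ< p<n
    i∈ : InBlock b t (toℕ i)
    i∈ rewrite i≡p = subst (_≤ toℕ p) (c-inc-≤ t b ℕP.≤-refl) (proj₁ p∈)
                   , ℕP.<-≤-trans p<p' (ℕ.s≤s⁻¹ (subst (toℕ p' <_) (c-inc-> t b ℕP.≤-refl) (proj₂ p'∈)))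

  R-injective : ∀ {σ σ' π} → OneFixed σ → OneFixed σ' → R σ π → R σ' π → σ ≡ σ'
  R-injective {π = π} ((_ , desc , _) , _) ((_ , desc' , _) , _) (p , p∈ , refl) (p' , p'∈ , refl) =
    cong (λ q → ins q q π) (FinP.toℕ-injective (ℕP.≤-antisym
      (ℕP.≮⇒≥ (¬two-places {p'} {p} {π} p'∈ p∈ fits' fits))
      (ℕP.≮⇒≥ (¬two-places {p} {p'} {π} p∈ p'∈ fits fits'))))
    where
    fits : Fits t b p p π
    fits = proj₂ (decreasing-ins⁻ t b p p π p∈ (descents⇒decreasing a (ins p p π) desc))
    fits' : Fits t b p' p' π
    fits' = proj₂ (decreasing-ins⁻ t b p' p' π p'∈ (descents⇒decreasing a (ins p' p' π) desc'))

  fixed-unique : ∀ {σ : Vec (Fin (suc n)) (suc n)} {p p'} → Decreasing a σ →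
    InBlock a t (toℕ p) → InBlock a t (toℕ p') → lookup σ p ≡ p → lookup σ p' ≡ p' → p ≡ p'
  fixed-unique {σ} {p} {p'} decr p∈ p'∈ e e' with ℕP.<-cmp (toℕ p) (toℕ p')
  ... | tri< p<p' _ _ = ⊥-elim (ℕP.<-asym p<p'
    (subst₂ (λ x y → toℕ x < toℕ y) e' e (decr t p p' p<p' p∈ p'∈)))
  ... | tri≈ _ p≡p' _ = FinP.toℕ-injective p≡p'
  ... | tri> _ _ p'<p = ⊥-elim (ℕP.<-asym p'<p
    (subst₂ (λ x y → toℕ x < toℕ y) e e' (decr t p' p p'<p p'∈ p∈)))

  R-functional : ∀ {σ π π'} → OneFixed σ → R σ π → R σ π' → π ≡ π'
  R-functional {π = π} {π'} ((_ , desc , _) , _) (p , p∈ , refl) (p' , p'∈ , e)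
    with fixed-unique {ins p p π} (descents⇒decreasing a (ins p p π) desc) p∈ p'∈ (lookup-ins-at p p π)
           (trans (cong (λ σ → lookup σ p') e) (lookup-ins-at p' p' π'))
  ... | refl = ins-injective p p e

  recurrence : length (listD (suc n) a (toℕ t)) ≡
               length (listD (suc n) a (suc (toℕ t))) + length (listD n b (suc (toℕ t)))
  recurrence = trans
    (length-filter-⊎ (inDₙ? a (toℕ t)) (inDₙ? a (suc (toℕ t))) oneFixed? (λ {σ} → split {σ})
      (λ {σ} (perm , desc , nf) → perm , desc , noFixedIn-weaken a (toℕ t) σ nf) proj₁
      (λ {σ} (_ , _ , nf) (_ , p , p∈ , e) → nf p (t , ℕP.≤-refl , p∈) e) all)
    (cong (_+_ (length (listD (suc n) a (suc (toℕ t))))) (length-≡ R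
      (UniqueP.filter⁺ oneFixed? (allVecs-unique (suc n) (suc n)))
      (listD-unique n b (suc (toℕ t)))
      (λ σ∈ → let π , π∈ , r = remove (fixed σ∈) in π , ∈-listD⁺ π∈ , r)
      (λ π∈ → let σ , σ∈ , r = insert (∈-listD⁻ π∈)
              in σ , ∈P.∈-filter⁺ oneFixed? (allVecs-complete σ) σ∈ , r)
      (λ σ∈ σ'∈ → R-injective (fixed σ∈) (fixed σ'∈))
      (λ σ∈ → R-functional (fixed σ∈))))
    where
    all : List (Vec (Fin (suc n)) (suc n))
    all = allVecs (suc n) (suc n)
    fixed : ∀ {σ} → σ ∈ filter oneFixed? all → OneFixed σ
    fixed σ∈ = proj₂ (∈P.∈-filter⁻ oneFixed? {xs = all} σ∈)
    split : ∀ {σ} → InDₙ a (toℕ t) σ → InDₙ a (suc (toℕ t)) σ ⊎ OneFixed σ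
    split {σ} σ∈@(perm , desc , nf) with fixedIn? a t σ
    ... | yes fix = inj₂ (σ∈ , fix)
    ... | no ¬fix = inj₁ (perm , desc , noFixedIn-suc a t σ nf ¬fix)

-- The coefficients at which multiplication by x_t contributes nothing: block `t` is empty, so its
-- condition is vacuous.
empty-block : ∀ {k} n (t : Fin k) a → dec t a ≡ nothing →
              length (listD n a (suc (toℕ t))) ≡ length (listD n a (toℕ t))
empty-block n t a e = cong length (ListP.filter-≐ _ _
  ( (λ {σ} (perm , desc , nf) → perm , desc , noFixedIn-weaken a (toℕ t) σ nf)
  , (λ {σ} (perm , desc , nf) → perm , desc , noFixedIn-suc a t σ nf
       (λ (p , (lo , hi) , _) → ℕP.<⇒≱ hi (subst (_≤ toℕ p) (sym (c-dec-nothing t a e)) lo))))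
  (allVecs n n))

-- Removing the largest value

module MaximumRemoval {k} (a : Vec ℕ k) (n : ℕ) (sum≡ : Vec.sum a ≡ suc n) where

  top : Fin (suc n)
  top = fromℕ n

  -- The tag `t` keeps the summands disjoint, as one `π` can arise from several blocks.
  smaller : Fin k → List (Fin k × Vec (Fin n) n)
  smaller t = maybe (λ b → List.map (t ,_) (listD n b 0)) [] (dec t a)

  R : Vec (Fin (suc n)) (suc n) → Fin k × Vec (Fin n) n → Set
  R σ (t , π) = ∃ λ b → dec t a ≡ just b × ∃ λ p → toℕ p ≡ c a (toℕ t) × σ ≡ ins p top π

  ∈-smaller⁺ : ∀ {t b π} → dec t a ≡ just b → InDₙ b 0 π → (t , π) ∈ smaller t
  ∈-smaller⁺ e π∈ rewrite e = ∈P.∈-map⁺ _ (∈-listD⁺ π∈)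

  ∈-smaller⁻ : ∀ {s t π} → (t , π) ∈ smaller s → s ≡ t × ∃ λ b → dec t a ≡ just b × InDₙ b 0 π
  ∈-smaller⁻ {s} tπ∈ with dec s a in e
  ... | just b with ∈P.∈-map⁻ _ tπ∈
  ...   | π , π∈ , refl = refl , b , e , ∈-listD⁻ π∈

  smaller-unique : ∀ t → Unique (smaller t)
  smaller-unique t with dec t a
  ... | just b  = UniqueP.map⁺ (λ { refl → refl }) (listD-unique n b 0)
  ... | nothing = []

  start∈ : ∀ {t b} → dec t a ≡ just b → ∀ {p} → p ≡ c a (toℕ t) → InBlock a t p
  start∈ {t} {b} e refl
    rewrite dec-just t a e | c-inc-≤ t b (ℕP.≤-refl {toℕ t}) | c-inc-> t b (ℕP.≤-refl {suc (toℕ t)})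
    = ℕP.≤-refl , s≤s (c-mono b (ℕP.n≤1+n (toℕ t)))

  noFixedIn-0 : ∀ {m} {b : Vec ℕ k} {π : Vec (Fin m) m} → NoFixedIn b 0 π
  noFixedIn-0 p (_ , () , _)

  -- Otherwise the first entry of the block would exceed `top`.
  top-at-start : ∀ {σ : Vec (Fin (suc n)) (suc n)} {t p} → Decreasing a σ → lookup σ p ≡ top →
                 InBlock a t (toℕ p) → toℕ p ≡ c a (toℕ t)
  top-at-start {σ} {t} {p} decr σp≡top (lo , hi) with ℕP.m≤n⇒m<n∨m≡n lo
  ... | inj₂ e   = sym e
  ... | inj₁ c<p = ⊥-elim (ℕP.<⇒≱ (decr t q p q<p q∈ (lo , hi))
                     (subst (λ x → toℕ (lookup σ q) ≤ toℕ x) (sym σp≡top) (FinP.≤fromℕ (lookup σ q))))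
    where
    c<1+n : c a (toℕ t) < suc n
    c<1+n = ℕP.<-trans c<p (FinP.toℕ<n p)
    q : Fin (suc n)
    q = fromℕ< c<1+n
    q<p : toℕ q < toℕ p
    q<p rewrite FinP.toℕ-fromℕ< c<1+n = c<p
    q∈ : InBlock a t (toℕ q)
    q∈ rewrite FinP.toℕ-fromℕ< c<1+n = ℕP.≤-refl , ℕP.<-trans c<p hi

  remove : ∀ {σ} → InDₙ a 0 σ → ∃ λ t → ∃ λ π → (t , π) ∈ smaller t × R σ (t , π)
  remove {σ} (perm , desc , nf) with proj₂ perm top
  ... | p , σp≡top with block-exists a (subst (toℕ p <_) (sym sum≡) (FinP.toℕ<n p))
  ... | t , p∈ with dec t a in e
  ... | nothing =
    ⊥-elim (ℕP.<⇒≱ (proj₂ p∈) (subst (_≤ toℕ p) (sym (c-dec-nothing t a e)) (proj₁ p∈)))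
  ... | just b with deletion σ p top perm σp≡top
  ... | π , refl = t , π
    , ∈-smaller⁺ e (isPerm-ins⁻ p top perm , decreasing⇒descents b π decr , noFixedIn-0 {b = b} {π})
    , b , e , p , top-at-start {ins p top π} {t} (descents⇒decreasing a (ins p top π) desc) σp≡top p∈ , refl
    where
    a≡ : a ≡ inc t b
    a≡ = dec-just t a e
    decr : Decreasing b π
    decr = proj₁ (decreasing-ins⁻ t b p top π (subst (λ a → InBlock a t (toℕ p)) a≡ p∈)
             (subst (λ a → Decreasing a (ins p top π)) a≡ (descents⇒decreasing a (ins p top π) desc)))

  insert : ∀ {t π b} → dec t a ≡ just b → InDₙ b 0 π → ∃ λ σ → InDₙ a 0 σ × R σ (t , π)
  insert {t} {π} {b} e (perm , desc , _) =
      ins p top π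
    , (isPerm-ins⁺ p top perm , decreasing⇒descents a (ins p top π) decr , noFixedIn-0 {b = a} {ins p top π})
    , b , e , p , p≡ , refl
    where
    a≡ : a ≡ inc t b
    a≡ = dec-just t a e
    c<1+n : c a (toℕ t) < suc n
    c<1+n = subst (c a (toℕ t) <_) sum≡ (ℕP.<-≤-trans (proj₂ (start∈ e refl)) (c≤sum a (suc (toℕ t))))
    p : Fin (suc n)
    p = fromℕ< c<1+n
    p≡ : toℕ p ≡ c a (toℕ t)
    p≡ = FinP.toℕ-fromℕ< c<1+n
    p≡' : toℕ p ≡ c b (toℕ t)
    p≡' = trans p≡ (trans (cong (λ a → c a (toℕ t)) a≡) (c-inc-≤ t b ℕP.≤-refl))
    -- No position of block `t` is left of its start, and every old value is below `top`.
    fits : Fits t b p top π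
    fits i (lo , _) =
        (λ i<p → ⊥-elim (ℕP.<⇒≱ i<p (subst (_≤ toℕ i) (sym p≡') lo)))
      , (λ _ → subst (toℕ (lookup π i) <_) (sym (FinP.toℕ-fromℕ n)) (FinP.toℕ<n (lookup π i)))
    decr : Decreasing a (ins p top π)
    decr = subst (λ a → Decreasing a (ins p top π)) (sym a≡)
      (decreasing-ins⁺ t b p top π (subst (λ a → InBlock a t (toℕ p)) a≡ (start∈ e p≡))
        (descents⇒decreasing b π desc) fits)

  R-injective : ∀ {σ σ' y} → R σ y → R σ' y → σ ≡ σ'
  R-injective {y = t , π} (_ , _ , p , p≡ , refl) (_ , _ , p' , p'≡ , refl) =
    cong (λ q → ins q top π) (FinP.toℕ-injective (trans p≡ (sym p'≡)))

  -- The position of `top` fixes `p`, but an empty block has the same start as the next one. It is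
  -- `dec t a ≡ just b` that places `p` inside block `t` and so determines `t`.
  R-functional : ∀ {σ y y'} → IsPerm σ → R σ y → R σ y' → y ≡ y'
  R-functional {y = t , π} {t' , π'} (inj , _) (_ , e , p , p≡ , refl) (_ , e' , p' , p'≡ , σ≡)
    with inj p p' (trans (lookup-ins-at p top π)
           (sym (trans (cong (λ σ → lookup σ p') σ≡) (lookup-ins-at p' top π'))))
  ... | refl with block-unique a {t} {t'} (start∈ e p≡) (start∈ e' p'≡)
  ... | refl = cong (t ,_) (ins-injective p top σ≡)

  recurrence : + length (listD (suc n) a 0) ≡ ∑ (λ t → + length (smaller t)) (allFin k)
  recurrence = trans (cong +_ (length-≡ R
      (listD-unique (suc n) a 0)
      (concatMap-unique smaller smaller-unique
        (λ {s} {s'} y∈ y∈' → trans (proj₁ (∈-smaller⁻ {s} y∈)) (sym (proj₁ (∈-smaller⁻ {s'} y∈'))))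
        (UniqueP.allFin⁺ k))
      (λ σ∈ → let t , π , tπ∈ , r = remove (∈-listD⁻ σ∈)
              in (t , π) , ∈P.∈-concatMap⁺ smaller (lose (∈P.∈-allFin t) tπ∈) , r)
      surj
      (λ {σ} {σ'} {y} _ _ → R-injective {σ} {σ'} {y})
      (λ σ∈ → R-functional (proj₁ (∈-listD⁻ {a = a} {j = 0} σ∈)))))
    (length-concatMap smaller (allFin k))
    where
    surj : ∀ {y} → y ∈ concatMap smaller (allFin k) → ∃ λ σ → σ ∈ listD (suc n) a 0 × R σ y
    surj {t , π} y∈ with find (∈P.∈-concatMap⁻ smaller {xs = allFin k} y∈)
    ... | s , _ , tπ∈ with ∈-smaller⁻ {s} {t} tπ∈
    ... | refl , b , e , π∈ with insert {t} e π∈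
    ... | σ , σ∈ , r = σ , ∈-listD⁺ σ∈ , r

-- The generating functions of the counts

sum-dec : ∀ {k} (t : Fin k) a {b} → dec t a ≡ just b → Vec.sum a ≡ suc (Vec.sum b)
sum-dec t a {b} e = trans (cong Vec.sum (dec-just t a e)) (sum-inc t b)

F : ∀ {k} → ℕ → Series k
F j a = + cardD a j

F-step : ∀ {k} (t : Fin k) → mul1+ t (F (suc (toℕ t))) ≈ F (toℕ t)
F-step t a with dec t a in e
... | nothing = trans (ℤP.+-identityʳ _) (cong +_ (empty-block (Vec.sum a) t a e))
... | just b rewrite dec-just t a e | sum-inc t b =
  cong +_ (sym (FixedPointRemoval.recurrence t b (Vec.sum b) refl))

F-base : ∀ {k} → F {k} 0 *S 1-vars ≈ oneS
F-base {k} a = trans (*S-1-vars (F 0) a) (go (Vec.sum a) refl)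
  where
  sum-zero : ∀ {k} (a : Vec ℕ k) → Vec.sum a ≡ 0 → a ≡ zeroVec
  sum-zero []         e = refl
  sum-zero (zero ∷ a) e = cong (0 ∷_) (sum-zero a e)
  go : ∀ n → Vec.sum a ≡ n → F 0 a ℤ.- ∑ (λ t → shift t (F 0) a) (allFin k) ≡ oneS a
  -- Once the length is rewritten to 0, the count evaluates to 1, the empty permutation.
  go zero e rewrite e | sum-zero a e = begin
    + 1 ℤ.- ∑ (λ t → shift t (F 0) (zeroVec {k})) (allFin k)
      ≡⟨ cong (λ z → + 1 ℤ.- z) (∑-zero (λ t → shift-zeroVec t (F 0)) (allFin k)) ⟩
    + 1
      ≡⟨ oneS-zeroVec {k} ⟨
    oneS (zeroVec {k}) ∎
  go (suc n) e = begin
    F 0 a ℤ.- ∑ (λ t → shift t (F 0) a) (allFin k)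
      ≡⟨ cong (λ z → F 0 a ℤ.- z) (∑-cong summand (allFin k)) ⟨
    F 0 a ℤ.- ∑ (λ t → + length (MaximumRemoval.smaller a n e t)) (allFin k)
      ≡⟨ cong (λ z → F 0 a ℤ.- z) (MaximumRemoval.recurrence a n e) ⟨
    F 0 a ℤ.- + length (listD (suc n) a 0)
      ≡⟨ cong (λ m → F 0 a ℤ.- + length (listD m a 0)) e ⟨
    F 0 a ℤ.- F 0 a
      ≡⟨ ℤP.+-inverseʳ (F 0 a) ⟩
    + 0
      ≡⟨ oneS-nonzero {a = a} (λ a≡0 → ℕP.0≢1+n
           (trans (sym (sum-zeroVec k)) (trans (cong Vec.sum (sym a≡0)) e))) ⟨
    oneS a ∎
    where
    summand : ∀ t → + length (MaximumRemoval.smaller a n e t) ≡ shift t (F 0) a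
    summand t with dec t a in e'
    ... | nothing = refl
    -- Identifies `n` with `Vec.sum b`, so that `listD n b 0` becomes the list counted by
    -- `cardD b 0`.
    ... | just b rewrite ℕP.suc-injective (trans (sym e) (sum-dec t a e')) =
      cong +_ (ListP.length-map (t ,_) (listD (Vec.sum b) b 0))

theorem2 : (k : ℕ) (a : Vec ℕ k) (j : ℕ) → j ≤ k →
    + cardD a j ≡ coeff (inverseS (denom k j)) a
theorem2 k a j j≤k =
  sym (inverseS-unique (denom k j) (F j) (denom-zeroVec k j) (telescope F F-step F-base j j≤k) a)
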